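{- Let $M$ be a simple matroid of rank $\ell$ on $[n]$ and let $I=I(M)\subset E$ be its Orlik–Solomon ideal. For every $p$ with $1\le p\le\ell$, the set $Z_p=\{z(T)\mid T\in\mathbf{nbc}_p\}$ forms a basis of the $R$-module $(I^0)_{n-p}$, the degree $n-p$ component of the annihilator ideal $I^0$.
   Context: $R$ is an arbitrary nonzero commutative ring with $1$. $M$ is a simple matroid (no loops, no nontrivial parallel classes) on $[n]=\{1,\dots,n\}$ of rank $\ell$. $E$ is the exterior algebra over $R$ on the free $R$-module with basis $e_1,\dots,e_n$, with the standard grading $E_p=\Lambda^p$. For $S=\{i_1<\dots<i_p\}\subset[n]$ put $e_S=e_{i_1}\cdots e_{i_p}$ ($e_\emptyset=1$). $\partial:E\to E$ is the $R$-linear map of degree $-1$ with $\partial e_i=1$ for all $i$ and $\partial(ab)=(\partial a)b+(-1)^{\deg a}a\,\partial b$ for homogeneous $a$ and all $b$. The Orlik–Solomon ideal $I=I(M)$ is the ideal of $E$ generated by $\partial e_S$ for all dependent sets $S$ of $M$. The annihilator is the graded ideal $I^0=\{a\in E\mid ab=0\text{ for every }b\in I\}$. A broken circuit is a circuit of $M$ with its smallest element deleted. A subset of $[n]$ is $\mathbf{nbc}$ if it contains no broken circuit; $\mathbf{nbc}_p$ is the set of $\mathbf{nbc}$-sets of cardinality $p$. $cl$ is the closure operator of $M$. Definition of $z(T)$ for $T=\{i_1<\dots<i_p\}\in\mathbf{nbc}_p$, $1\le p\le \ell$: put $X_0=\emptyset$, $X_q=cl(\{i_{p-q+1},\dots,i_p\})$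 and $S_q=X_q\setminus X_{q-1}$ for $1\le q\le p$. Then $S_1,\dots,S_p$ partition $X_p$ and $$z(T)=\mathrm{sign}(\sigma)\,\partial(e_{S_1})\partial(e_{S_2})\cdots\partial(e_{S_p})\,e_{[n]\setminus X_p},$$ where $\sigma$ is the permutation of $[n]$ listing the elements of $S_1$, then $S_2$, ..., then $S_p$, then $[n]\setminus X_p$, each block in increasing order. -}

module Defs where

open import Algebra.Bundles using (CommutativeRing; Ring)
import Algebra.Properties.CommutativeSemigroup as CommutativeSemigroupProperties
import Algebra.Properties.Ring as RingProperties
open import Data.Bool.Base using (if_then_else_; true; false)
import Data.Bool.Properties as Bool
open import Data.Fin.Base as Fin using (Fin; zero; suc)
import Data.Fin.Properties as Fin
open import Data.Fin.Subset as Subset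
  using (Subset; inside; outside; _∈_; _⊆_; _⊂_; _∪_; _─_; ∁; ⁅_⁆; ⋃; ∣_∣)
open import Data.Fin.Subset.Properties using (_∈?_; _⊆?_; _⊂?_; anySubset?; ∣⊥∣≡0; ∣⁅x⁆∣≡1)
open import Data.List.Base
  using (List; []; _∷_; _++_; map; concatMap; filter; foldr; length; drop; upTo; allFin; tabulate)
import Data.List.Properties as List
open import Data.Nat.Base as ℕ using (ℕ; zero; suc; _∸_; _⊔_)
import Data.Nat.Properties as ℕ
open import Data.Product.Base using (_×_; _,_; ∃; ∃-syntax)
import Data.Vec.Base as Vec
open import Data.Vec.Base using (Vec; []; _∷_)
import Data.Vec.Properties as Vec
open import Function.Base using (_∘_)
open import Level using (0ℓ) renaming (_⊔_ to _⊔ˡ_)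
open import Relation.Binary.Bundles using (Setoid)
open import Relation.Binary.PropositionalEquality as ≡ using (_≡_; _≢_)
import Relation.Binary.Reasoning.Setoid as SetoidReasoning
open import Relation.Nullary using (¬_; Dec; contradiction; yes; no; does; _×-dec_; _→-dec_; ¬?)
open import Relation.Nullary.Decidable as Dec using (decidable-stable)
open import Relation.Unary using (Pred; Decidable)

private
  variable
    n : ℕ

-- In increasing order.
elements : Subset n → List (Fin n)
elements S = filter (_∈? S) (allFin _)

fromList : List (Fin n) → Subset n
fromList = ⋃ ∘ map ⁅_⁆

subsets : ∀ n → List (Subset n)
subsets zero    = [] ∷ []
subsets (suc n) = map (outside ∷_) (subsets n) ++ map (inside ∷_) (subsets n)

_≟ˢ_ : (S T : Subset n) → Dec (S ≡ T)
_≟ˢ_ = Vec.≡-dec Bool._≟_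

allSubsets? : ∀ {p} {P : Pred (Subset n) p} → Decidable P → Dec (∀ S → P S)
allSubsets? P? = Dec.map′
  (λ ∄¬P S → decidable-stable (P? S) (λ ¬PS → ∄¬P (S , ¬PS)))
  (λ ∀P (S , ¬PS) → ¬PS (∀P S))
  (¬? (anySubset? (¬? ∘ P?)))

-- If xs lists every element of [n] once, the sign of that permutation is (-1)^(inversions xs).
inversions : List (Fin n) → ℕ
inversions []       = 0
inversions (x ∷ xs) = length (filter (Fin._<? x) xs) ℕ.+ inversions xs

record Matroid (n : ℕ) : Set₁ where
  field
    Indep        : Pred (Subset n) 0ℓ
    indep?       : Decidable Indep
    ∅-indep      : Indep Subset.⊥
    hereditary   : ∀ {A B} → A ⊆ B → Indep B → Indep A
    augmentation : ∀ {A B} → Indep A → Indep B → ∣ A ∣ ℕ.< ∣ B ∣ →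
                   ∃[ x ] x ∈ B × ¬ x ∈ A × Indep (A ∪ ⁅ x ⁆)

  Dependent : Pred (Subset n) 0ℓ
  Dependent S = ¬ Indep S

  Circuit : Pred (Subset n) 0ℓ
  Circuit C = Dependent C × (∀ A → A ⊂ C → Indep A)

  Loop : Pred (Fin n) 0ℓ
  Loop i = Circuit ⁅ i ⁆

  Parallel : Fin n → Fin n → Set
  Parallel i j = i ≢ j × Circuit (⁅ i ⁆ ∪ ⁅ j ⁆)

  Simple : Set
  Simple = (∀ i → ¬ Loop i) × (∀ i j → ¬ Parallel i j)

  rank : Subset n → ℕ
  rank S = foldr _⊔_ 0 (map ∣_∣ (filter (λ A → (A ⊆? S) ×-dec indep? A) (subsets n)))

  cl : Subset n → Subset n
  cl S = Vec.tabulate λ i → does (rank (S ∪ ⁅ i ⁆) ℕ.≟ rank S)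

  IsMin : Fin n → Subset n → Set
  IsMin i S = i ∈ S × (∀ j → j ∈ S → i Fin.≤ j)

  BrokenCircuit : Pred (Subset n) 0ℓ
  BrokenCircuit B = ∃[ C ] ∃[ i ] Circuit C × IsMin i C × B ≡ C Subset.- i

  NBC : Pred (Subset n) 0ℓ
  NBC T = ∀ B → BrokenCircuit B → ¬ B ⊆ T

  circuit? : Decidable Circuit
  circuit? C = ¬? (indep? C) ×-dec allSubsets? (λ A → (A ⊂? C) →-dec indep? A)

  isMin? : ∀ i → Decidable (IsMin i)
  isMin? i S = (i ∈? S) ×-dec Fin.all? (λ j → (j ∈? S) →-dec (i Fin.≤? j))

  brokenCircuit? : Decidable BrokenCircuit
  brokenCircuit? B = anySubset? λ C → Fin.any? λ i →
    circuit? C ×-dec isMin? i C ×-dec (B ≟ˢ (C Subset.- i))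

  nbc? : Decidable NBC
  nbc? T = allSubsets? λ B → brokenCircuit? B →-dec ¬? (B ⊆? T)

  nbc : ℕ → List (Subset n)
  nbc p = filter (λ T → nbc? T ×-dec (∣ T ∣ ℕ.≟ p)) (subsets n)

module Exterior {c ℓ} (R : CommutativeRing c ℓ) where

  open CommutativeRing R
  open import Algebra.Properties.Semiring.Exp semiring using (_^_)

  infix  4 _≈ᴱ_
  infixl 6 _+ᴱ_
  infixr 7 _·_
  infixl 7 _∧_

  -- An element is given by its coordinates: a represents Σ_S a(S) e_S,
  -- where e_S = e_{i₁}⋯e_{i_p} for S = {i₁ < ⋯ < i_p} (see e≈basis).
  -- That this is the exterior algebra: exteriorRing, ·-∧, ∧-·, ∧-alternating.
  E : ℕ → Set c
  E n = Subset n → Carrier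

  _≈ᴱ_ : E n → E n → Set ℓ
  a ≈ᴱ b = ∀ S → a S ≈ b S

  0ᴱ : E n
  0ᴱ S = 0#

  _+ᴱ_ : E n → E n → E n
  (a +ᴱ b) S = a S + b S

  -ᴱ_ : E n → E n
  (-ᴱ a) S = - a S

  _·_ : Carrier → E n → E n
  (r · a) S = r * a S

  basis : Subset n → E n
  basis S T = if does (S ≟ˢ T) then 1# else 0#

  1ᴱ : E n
  1ᴱ = basis Subset.⊥

  gen : Fin n → E n
  gen i = basis ⁅ i ⁆

  Homogeneous : ℕ → E n → Set ℓ
  Homogeneous p a = ∀ S → ∣ S ∣ ≢ p → a S ≈ 0#

  sgn : ℕ → Carrier
  sgn k = (- 1#) ^ k

  -- The grade involution, a ↦ (-1)^(deg a) a.
  inv : E n → E n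
  inv a S = sgn ∣ S ∣ * a S

  -- Splitting off the least generator: a = a₀ + e₁ a₁, with a₀ and a₁ in the
  -- subalgebra on the other generators.
  _₀ _₁ : E (suc n) → E n
  (a ₀) S = a (outside ∷ S)
  (a ₁) S = a (inside ∷ S)

  -- (a₀ + e₁ a₁)(b₀ + e₁ b₁) = a₀ b₀ + e₁ (a₁ b₀ + inv(a₀) b₁)
  _∧_ : E n → E n → E n
  _∧_ {zero}  a b []            = a [] * b []
  _∧_ {suc n} a b (outside ∷ S) = (a ₀ ∧ b ₀) S
  _∧_ {suc n} a b (inside  ∷ S) = (a ₁ ∧ b ₀) S + (inv (a ₀) ∧ b ₁) S

  ∏ : List (E n) → E n
  ∏ = foldr _∧_ 1ᴱ

  e : Subset n → E n
  e S = ∏ (map gen (elements S))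

  -- ∂(a₀ + e₁ a₁) = (∂a₀ + a₁) - e₁ ∂a₁; see ∂-isDifferential and ∂-unique.
  ∂ : E n → E n
  ∂ {zero}  a []            = 0#
  ∂ {suc n} a (outside ∷ S) = ∂ (a ₀) S + (a ₁) S
  ∂ {suc n} a (inside  ∷ S) = - ∂ (a ₁) S

  record IsDifferential (D : E n → E n) : Set (c ⊔ˡ ℓ) where
    field
      cong    : ∀ {a b} → a ≈ᴱ b → D a ≈ᴱ D b
      +-homo  : ∀ a b → D (a +ᴱ b) ≈ᴱ D a +ᴱ D b
      ·-homo  : ∀ r a → D (r · a) ≈ᴱ r · D a
      degree  : ∀ p {a} → Homogeneous (suc p) a → Homogeneous p (D a)
      degree₀ : ∀ {a} → Homogeneous 0 a → D a ≈ᴱ 0ᴱ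
      gen↦1   : ∀ i → D (gen i) ≈ᴱ 1ᴱ
      leibniz : ∀ p {a} → Homogeneous p a → ∀ b →
                D (a ∧ b) ≈ᴱ (D a ∧ b) +ᴱ sgn p · (a ∧ D b)

  IsNontrivial : Set ℓ
  IsNontrivial = ¬ 1# ≈ 0#

  ∑ : ∀ {k} → (Fin k → E n) → E n
  ∑ v = foldr _+ᴱ_ 0ᴱ (tabulate v)

  -- v is a basis of the submodule of E n whose elements are those satisfying P.
  record IsBasis {p} (P : Pred (E n) p) {k : ℕ} (v : Fin k → E n) : Set (c ⊔ˡ ℓ ⊔ˡ p) where
    field
      member      : ∀ i → P (v i)
      independent : ∀ (r : Fin k → Carrier) → ∑ (λ i → r i · v i) ≈ᴱ 0ᴱ → ∀ i → r i ≈ 0#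
      spanning    : ∀ a → P a → ∃ λ (r : Fin k → Carrier) → a ≈ᴱ ∑ (λ i → r i · v i)

  private
    open module Rₚ = RingProperties ring using (-0#≈0#; -‿distribˡ-*; -‿distribʳ-*; -‿+-comm; -1*x≈-x; -‿involutive)
    module +ₚ = CommutativeSemigroupProperties (CommutativeRing.+-commutativeSemigroup R)
    module *ₚ = CommutativeSemigroupProperties (CommutativeRing.*-commutativeSemigroup R)
    open SetoidReasoning setoid

    +-cancelMiddle : ∀ w x y z → x + y ≈ 0# → (w + x) + (y + z) ≈ w + z
    +-cancelMiddle w x y z x+y≈0 = begin
      (w + x) + (y + z) ≈⟨ +-assoc w x (y + z) ⟩
      w + (x + (y + z)) ≈⟨ +-congˡ (+-assoc x y z) ⟨
      w + ((x + y) + z) ≈⟨ +-congˡ (+-congʳ x+y≈0) ⟩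
      w + (0# + z)      ≈⟨ +-congˡ (+-identityˡ z) ⟩
      w + z             ∎

  ≈ᴱ-setoid : ℕ → Setoid c ℓ
  ≈ᴱ-setoid n = record
    { Carrier = E n
    ; _≈_ = _≈ᴱ_
    ; isEquivalence = record
      { refl  = λ S → refl
      ; sym   = λ a≈b S → sym (a≈b S)
      ; trans = λ a≈b b≈c S → trans (a≈b S) (b≈c S)
      }
    }

  inv-cong : {a b : E n} → a ≈ᴱ b → inv a ≈ᴱ inv b
  inv-cong a≈b S = *-congˡ (a≈b S)

  inv-0 : inv {n} 0ᴱ ≈ᴱ 0ᴱ
  inv-0 S = zeroʳ _

  inv-+ : (a b : E n) → inv (a +ᴱ b) ≈ᴱ inv a +ᴱ inv b
  inv-+ a b S = distribˡ _ _ _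

  inv-· : ∀ r (a : E n) → inv (r · a) ≈ᴱ r · inv a
  inv-· r a S = *ₚ.x∙yz≈y∙xz _ r (a S)

  inv-neg : (a : E n) → inv (-ᴱ a) ≈ᴱ -ᴱ inv a
  inv-neg a S = sym (-‿distribʳ-* _ _)

  inv-₁ : (a : E (suc n)) → inv a ₁ ≈ᴱ -ᴱ inv (a ₁)
  inv-₁ a S = trans (*-congʳ (-1*x≈-x _)) (sym (-‿distribˡ-* _ _))

  inv-inv : (a : E n) → inv (inv a) ≈ᴱ a
  inv-inv a S = begin
    sgn ∣ S ∣ * (sgn ∣ S ∣ * a S) ≈⟨ *-assoc _ _ _ ⟨
    (sgn ∣ S ∣ * sgn ∣ S ∣) * a S ≈⟨ *-congʳ (sgn² ∣ S ∣) ⟩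
    1# * a S                      ≈⟨ *-identityˡ _ ⟩
    a S                           ∎
    where
    sgn² : ∀ k → sgn k * sgn k ≈ 1#
    sgn² zero    = *-identityˡ 1#
    sgn² (suc k) = begin
      (- 1# * sgn k) * (- 1# * sgn k) ≈⟨ *-cong (-1*x≈-x _) (-1*x≈-x _) ⟩
      - sgn k * - sgn k               ≈⟨ -‿distribˡ-* _ _ ⟨
      - (sgn k * - sgn k)             ≈⟨ -‿cong (-‿distribʳ-* _ _) ⟨
      - (- (sgn k * sgn k))           ≈⟨ -‿involutive _ ⟩
      sgn k * sgn k                   ≈⟨ sgn² k ⟩
      1#                              ∎

  homogeneous⇒inv : ∀ p {a : E n} → Homogeneous p a → inv a ≈ᴱ sgn p · a
  homogeneous⇒inv p {a} hom S with ∣ S ∣ ℕ.≟ p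
  ... | yes ∣S∣≡p = reflexive (≡.cong (λ k → sgn k * a S) ∣S∣≡p)
  ... | no  ∣S∣≢p = begin
    sgn ∣ S ∣ * a S ≈⟨ *-congˡ (hom S ∣S∣≢p) ⟩
    sgn ∣ S ∣ * 0#  ≈⟨ zeroʳ _ ⟩
    0#              ≈⟨ zeroʳ _ ⟨
    sgn p * 0#      ≈⟨ *-congˡ (hom S ∣S∣≢p) ⟨
    sgn p * a S     ∎

  ∧-cong : {a b a′ b′ : E n} → a ≈ᴱ a′ → b ≈ᴱ b′ → a ∧ b ≈ᴱ a′ ∧ b′
  ∧-cong {zero}  p q []            = *-cong (p []) (q [])
  ∧-cong {suc n} p q (outside ∷ S) = ∧-cong (p ∘ (outside ∷_)) (q ∘ (outside ∷_)) S
  ∧-cong {suc n} p q (inside  ∷ S) = +-cong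
    (∧-cong (p ∘ (inside ∷_)) (q ∘ (outside ∷_)) S)
    (∧-cong (inv-cong (p ∘ (outside ∷_))) (q ∘ (inside ∷_)) S)

  ∧-congˡ : {a b b′ : E n} → b ≈ᴱ b′ → a ∧ b ≈ᴱ a ∧ b′
  ∧-congˡ = ∧-cong (λ _ → refl)

  ∧-congʳ : {a a′ b : E n} → a ≈ᴱ a′ → a ∧ b ≈ᴱ a′ ∧ b
  ∧-congʳ p = ∧-cong p (λ _ → refl)

  ∧-distribˡ : (a b c : E n) → a ∧ (b +ᴱ c) ≈ᴱ (a ∧ b) +ᴱ (a ∧ c)
  ∧-distribˡ {zero}  a b c []            = distribˡ _ _ _
  ∧-distribˡ {suc n} a b c (outside ∷ S) = ∧-distribˡ (a ₀) (b ₀) (c ₀) S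
  ∧-distribˡ {suc n} a b c (inside  ∷ S) = trans
    (+-cong (∧-distribˡ (a ₁) (b ₀) (c ₀) S) (∧-distribˡ (inv (a ₀)) (b ₁) (c ₁) S))
    (+ₚ.interchange _ _ _ _)

  ∧-distribʳ : (c a b : E n) → (a +ᴱ b) ∧ c ≈ᴱ (a ∧ c) +ᴱ (b ∧ c)
  ∧-distribʳ {zero}  c a b []            = distribʳ _ _ _
  ∧-distribʳ {suc n} c a b (outside ∷ S) = ∧-distribʳ (c ₀) (a ₀) (b ₀) S
  ∧-distribʳ {suc n} c a b (inside  ∷ S) = trans
    (+-cong (∧-distribʳ (c ₀) (a ₁) (b ₁) S)
            (trans (∧-congʳ (inv-+ (a ₀) (b ₀)) S) (∧-distribʳ (c ₁) (inv (a ₀)) (inv (b ₀)) S)))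
    (+ₚ.interchange _ _ _ _)

  ·-∧ : ∀ r (a b : E n) → (r · a) ∧ b ≈ᴱ r · (a ∧ b)
  ·-∧ {zero}  r a b []            = *-assoc _ _ _
  ·-∧ {suc n} r a b (outside ∷ S) = ·-∧ r (a ₀) (b ₀) S
  ·-∧ {suc n} r a b (inside  ∷ S) = trans
    (+-cong (·-∧ r (a ₁) (b ₀) S)
            (trans (∧-congʳ (inv-· r (a ₀)) S) (·-∧ r (inv (a ₀)) (b ₁) S)))
    (sym (distribˡ _ _ _))

  ∧-· : ∀ r (a b : E n) → a ∧ (r · b) ≈ᴱ r · (a ∧ b)
  ∧-· {zero}  r a b []            = *ₚ.x∙yz≈y∙xz _ _ _
  ∧-· {suc n} r a b (outside ∷ S) = ∧-· r (a ₀) (b ₀) S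
  ∧-· {suc n} r a b (inside  ∷ S) = trans
    (+-cong (∧-· r (a ₁) (b ₀) S) (∧-· r (inv (a ₀)) (b ₁) S))
    (sym (distribˡ _ _ _))

  ∧-negˡ : (a b : E n) → (-ᴱ a) ∧ b ≈ᴱ -ᴱ (a ∧ b)
  ∧-negˡ a b S = begin
    ((-ᴱ a) ∧ b) S       ≈⟨ ∧-congʳ (λ T → -1*x≈-x (a T)) S ⟨
    ((- 1# · a) ∧ b) S   ≈⟨ ·-∧ (- 1#) a b S ⟩
    - 1# * (a ∧ b) S     ≈⟨ -1*x≈-x _ ⟩
    - (a ∧ b) S          ∎

  ∧-negʳ : (a b : E n) → a ∧ (-ᴱ b) ≈ᴱ -ᴱ (a ∧ b)
  ∧-negʳ a b S = begin
    (a ∧ (-ᴱ b)) S       ≈⟨ ∧-congˡ (λ T → -1*x≈-x (b T)) S ⟨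
    (a ∧ (- 1# · b)) S   ≈⟨ ∧-· (- 1#) a b S ⟩
    - 1# * (a ∧ b) S     ≈⟨ -1*x≈-x _ ⟩
    - (a ∧ b) S          ∎

  ∧-zeroˡ : (a : E n) → 0ᴱ ∧ a ≈ᴱ 0ᴱ
  ∧-zeroˡ a S = begin
    (0ᴱ ∧ a) S        ≈⟨ ∧-congʳ (λ T → zeroˡ 0#) S ⟨
    ((0# · 0ᴱ) ∧ a) S ≈⟨ ·-∧ 0# 0ᴱ a S ⟩
    0# * (0ᴱ ∧ a) S   ≈⟨ zeroˡ _ ⟩
    0#                ∎

  ∧-zeroʳ : (a : E n) → a ∧ 0ᴱ ≈ᴱ 0ᴱ
  ∧-zeroʳ a S = begin
    (a ∧ 0ᴱ) S        ≈⟨ ∧-congˡ (λ T → zeroˡ 0#) S ⟨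
    (a ∧ (0# · 0ᴱ)) S ≈⟨ ∧-· 0# a 0ᴱ S ⟩
    0# * (a ∧ 0ᴱ) S   ≈⟨ zeroˡ _ ⟩
    0#                ∎

  inv-∧ : (a b : E n) → inv (a ∧ b) ≈ᴱ inv a ∧ inv b
  inv-∧ {zero}  a b []            = begin
    1# * (a [] * b [])        ≈⟨ *-identityˡ _ ⟩
    a [] * b []               ≈⟨ *-cong (*-identityˡ _) (*-identityˡ _) ⟨
    (1# * a []) * (1# * b []) ∎
  inv-∧ {suc n} a b (outside ∷ S) = inv-∧ (a ₀) (b ₀) S
  inv-∧ {suc n} a b (inside  ∷ S) = begin
    inv (a ∧ b) (inside ∷ S)
      ≈⟨ inv-₁ (a ∧ b) S ⟩
    - inv ((a ₁ ∧ b ₀) +ᴱ (inv (a ₀) ∧ b ₁)) S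
      ≈⟨ -‿cong (inv-+ (a ₁ ∧ b ₀) (inv (a ₀) ∧ b ₁) S) ⟩
    - (inv (a ₁ ∧ b ₀) S + inv (inv (a ₀) ∧ b ₁) S)
      ≈⟨ -‿+-comm _ _ ⟨
    - inv (a ₁ ∧ b ₀) S + - inv (inv (a ₀) ∧ b ₁) S
      ≈⟨ +-cong (-‿cong (inv-∧ (a ₁) (b ₀) S)) (-‿cong (inv-∧ (inv (a ₀)) (b ₁) S)) ⟩
    - (inv (a ₁) ∧ inv (b ₀)) S + - (inv (inv (a ₀)) ∧ inv (b ₁)) S
      ≈⟨ +-cong (∧-negˡ (inv (a ₁)) (inv (b ₀)) S) (∧-negʳ (inv (inv (a ₀))) (inv (b ₁)) S) ⟨
    ((-ᴱ inv (a ₁)) ∧ inv (b ₀)) S + (inv (inv (a ₀)) ∧ (-ᴱ inv (b ₁))) S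
      ≈⟨ +-cong (∧-congʳ (inv-₁ a) S) (∧-congˡ (inv-₁ b) S) ⟨
    (inv a ∧ inv b) (inside ∷ S) ∎

  ∧-assoc : (a b c : E n) → (a ∧ b) ∧ c ≈ᴱ a ∧ (b ∧ c)
  ∧-assoc {zero}  a b c []            = *-assoc _ _ _
  ∧-assoc {suc n} a b c (outside ∷ S) = ∧-assoc (a ₀) (b ₀) (c ₀) S
  ∧-assoc {suc n} a b c (inside  ∷ S) = begin
    (((a ₁ ∧ b ₀) +ᴱ (inv (a ₀) ∧ b ₁)) ∧ c ₀) S + (inv (a ₀ ∧ b ₀) ∧ c ₁) S
      ≈⟨ +-cong (∧-distribʳ (c ₀) (a ₁ ∧ b ₀) (inv (a ₀) ∧ b ₁) S) (∧-congʳ (inv-∧ (a ₀) (b ₀)) S) ⟩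
    (((a ₁ ∧ b ₀) ∧ c ₀) S + ((inv (a ₀) ∧ b ₁) ∧ c ₀) S) + ((inv (a ₀) ∧ inv (b ₀)) ∧ c ₁) S
      ≈⟨ +-assoc _ _ _ ⟩
    ((a ₁ ∧ b ₀) ∧ c ₀) S + (((inv (a ₀) ∧ b ₁) ∧ c ₀) S + ((inv (a ₀) ∧ inv (b ₀)) ∧ c ₁) S)
      ≈⟨ +-cong (∧-assoc (a ₁) (b ₀) (c ₀) S)
                (+-cong (∧-assoc (inv (a ₀)) (b ₁) (c ₀) S) (∧-assoc (inv (a ₀)) (inv (b ₀)) (c ₁) S)) ⟩
    (a ₁ ∧ (b ₀ ∧ c ₀)) S + ((inv (a ₀) ∧ (b ₁ ∧ c ₀)) S + (inv (a ₀) ∧ (inv (b ₀) ∧ c ₁)) S)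
      ≈⟨ +-congˡ (∧-distribˡ (inv (a ₀)) (b ₁ ∧ c ₀) (inv (b ₀) ∧ c ₁) S) ⟨
    (a ₁ ∧ (b ₀ ∧ c ₀)) S + (inv (a ₀) ∧ ((b ₁ ∧ c ₀) +ᴱ (inv (b ₀) ∧ c ₁))) S ∎

  basis-homogeneous : (S : Subset n) → Homogeneous ∣ S ∣ (basis S)
  basis-homogeneous S T ∣T∣≢∣S∣ with S ≟ˢ T
  ... | yes ≡.refl = contradiction ≡.refl ∣T∣≢∣S∣
  ... | no  _      = refl

  1-homogeneous : Homogeneous {n} 0 1ᴱ
  1-homogeneous {n} = ≡.subst (λ k → Homogeneous {n} k 1ᴱ) (∣⊥∣≡0 n) (basis-homogeneous {n} Subset.⊥)

  gen-homogeneous : (i : Fin n) → Homogeneous 1 (gen i)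
  gen-homogeneous i = ≡.subst (λ k → Homogeneous k (gen i)) (∣⁅x⁆∣≡1 i) (basis-homogeneous ⁅ i ⁆)

  inv-1 : inv {n} 1ᴱ ≈ᴱ 1ᴱ
  inv-1 {n} S = trans
    (homogeneous⇒inv 0 (1-homogeneous {n}) S)
    (*-identityˡ _)

  ∧-identityˡ : (a : E n) → 1ᴱ ∧ a ≈ᴱ a
  ∧-identityˡ {zero}  a []            = *-identityˡ _
  ∧-identityˡ {suc n} a (outside ∷ S) = ∧-identityˡ (a ₀) S
  ∧-identityˡ {suc n} a (inside  ∷ S) = begin
    (0ᴱ ∧ a ₀) S + (inv 1ᴱ ∧ a ₁) S ≈⟨ +-cong (∧-zeroˡ (a ₀) S) (∧-congʳ inv-1 S) ⟩
    0# + (1ᴱ ∧ a ₁) S               ≈⟨ +-identityˡ _ ⟩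
    (1ᴱ ∧ a ₁) S                    ≈⟨ ∧-identityˡ (a ₁) S ⟩
    a (inside ∷ S)                  ∎

  ∧-identityʳ : (a : E n) → a ∧ 1ᴱ ≈ᴱ a
  ∧-identityʳ {zero}  a []            = *-identityʳ _
  ∧-identityʳ {suc n} a (outside ∷ S) = ∧-identityʳ (a ₀) S
  ∧-identityʳ {suc n} a (inside  ∷ S) = begin
    (a ₁ ∧ 1ᴱ) S + (inv (a ₀) ∧ 0ᴱ) S ≈⟨ +-cong (∧-identityʳ (a ₁) S) (∧-zeroʳ (inv (a ₀)) S) ⟩
    a (inside ∷ S) + 0#               ≈⟨ +-identityʳ _ ⟩
    a (inside ∷ S)                    ∎

  exteriorRing : ℕ → Ring c ℓ
  exteriorRing n = record
    { Carrier = E n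
    ; _≈_ = _≈ᴱ_
    ; _+_ = _+ᴱ_
    ; _*_ = _∧_
    ; -_  = -ᴱ_
    ; 0#  = 0ᴱ
    ; 1#  = 1ᴱ
    ; isRing = record
      { +-isAbelianGroup = record
        { isGroup = record
          { isMonoid = record
            { isSemigroup = record
              { isMagma = record
                { isEquivalence = Setoid.isEquivalence (≈ᴱ-setoid n)
                ; ∙-cong = λ p q S → +-cong (p S) (q S)
                }
              ; assoc = λ a b c S → +-assoc (a S) (b S) (c S)
              }
            ; identity = (λ a S → +-identityˡ (a S)) , (λ a S → +-identityʳ (a S))
            }
          ; inverse = (λ a S → -‿inverseˡ (a S)) , (λ a S → -‿inverseʳ (a S))
          ; ⁻¹-cong = λ p S → -‿cong (p S)
          }
        ; comm = λ a b S → +-comm (a S) (b S)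
        }
      ; *-cong = ∧-cong
      ; *-assoc = ∧-assoc
      ; *-identity = ∧-identityˡ , ∧-identityʳ
      ; distrib = ∧-distribˡ , ∧-distribʳ
      }
    }

  private
    homogeneous-₀ : ∀ p {a : E (suc n)} → Homogeneous p a → Homogeneous p (a ₀)
    homogeneous-₀ p hom S = hom (outside ∷ S)

    homogeneous-₁ : ∀ p {a : E (suc n)} → Homogeneous (suc p) a → Homogeneous p (a ₁)
    homogeneous-₁ p hom S ∣S∣≢p = hom (inside ∷ S) (∣S∣≢p ∘ ℕ.suc-injective)

    scalar : {a : E n} → Homogeneous 0 a → a ≈ᴱ a Subset.⊥ · 1ᴱ
    scalar {a = a} hom S with Subset.⊥ ≟ˢ S
    ... | yes ≡.refl = sym (*-identityʳ _)
    ... | no  ⊥≢S    = trans (hom S (λ ∣S∣≡0 → ⊥≢S (≡.sym (∣p∣≡0→p≡⊥ S ∣S∣≡0)))) (sym (zeroʳ _))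
      where
      ∣p∣≡0→p≡⊥ : ∀ {m} (T : Subset m) → ∣ T ∣ ≡ 0 → T ≡ Subset.⊥
      ∣p∣≡0→p≡⊥ []            _ = ≡.refl
      ∣p∣≡0→p≡⊥ (outside ∷ T) q = ≡.cong (outside ∷_) (∣p∣≡0→p≡⊥ T q)

  ∧-alternating : (a : E n) → Homogeneous 1 a → a ∧ a ≈ᴱ 0ᴱ
  ∧-alternating {zero}  a hom []            = trans (*-congˡ (hom [] λ ())) (zeroʳ _)
  ∧-alternating {suc n} a hom (outside ∷ S) = ∧-alternating (a ₀) (homogeneous-₀ 1 hom) S
  ∧-alternating {suc n} a hom (inside  ∷ S) = begin
    (a ₁ ∧ a ₀) S + (inv (a ₀) ∧ a ₁) S                   ≈⟨ +-cong left right ⟩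
    r * (a ₀) S + - (r * (a ₀) S)                         ≈⟨ -‿inverseʳ _ ⟩
    0#                                                    ∎
    where
    r : Carrier
    r = (a ₁) Subset.⊥
    a₁≈r : a ₁ ≈ᴱ r · 1ᴱ
    a₁≈r = scalar (homogeneous-₁ 0 hom)
    left : (a ₁ ∧ a ₀) S ≈ r * (a ₀) S
    left = begin
      (a ₁ ∧ a ₀) S        ≈⟨ ∧-congʳ a₁≈r S ⟩
      ((r · 1ᴱ) ∧ a ₀) S   ≈⟨ ·-∧ r 1ᴱ (a ₀) S ⟩
      r * (1ᴱ ∧ a ₀) S     ≈⟨ *-congˡ (∧-identityˡ (a ₀) S) ⟩
      r * (a ₀) S          ∎
    right : (inv (a ₀) ∧ a ₁) S ≈ - (r * (a ₀) S)
    right = begin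
      (inv (a ₀) ∧ a ₁) S      ≈⟨ ∧-congˡ a₁≈r S ⟩
      (inv (a ₀) ∧ (r · 1ᴱ)) S ≈⟨ ∧-· r (inv (a ₀)) 1ᴱ S ⟩
      r * (inv (a ₀) ∧ 1ᴱ) S   ≈⟨ *-congˡ (∧-identityʳ (inv (a ₀)) S) ⟩
      r * inv (a ₀) S          ≈⟨ *-congˡ (homogeneous⇒inv 1 (homogeneous-₀ 1 hom) S) ⟩
      r * (sgn 1 * (a ₀) S)    ≈⟨ *-congˡ (*-congʳ (*-identityʳ (- 1#))) ⟩
      r * (- 1# * (a ₀) S)     ≈⟨ *-congˡ (-1*x≈-x _) ⟩
      r * - (a ₀) S            ≈⟨ -‿distribʳ-* _ _ ⟨
      - (r * (a ₀) S)          ∎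

  private
    elements-∷ : ∀ s (S : Subset n) →
      filter (_∈? (s ∷ S)) (tabulate suc) ≡ map suc (elements S)
    elements-∷ {n} s S = ≡.trans
      (≡.cong (filter (_∈? (s ∷ S))) (≡.sym (List.map-tabulate (λ i → i) suc)))
      (go (allFin n))
      where
      go : ∀ xs → filter (_∈? (s ∷ S)) (map suc xs) ≡ map suc (filter (_∈? S) xs)
      go []       = ≡.refl
      go (x ∷ xs) with does (x ∈? S)
      ... | false = go xs
      ... | true  = ≡.cong (suc x ∷_) (go xs)

    ∏gen-suc-₀ : (xs : List (Fin n)) → ∏ (map gen (map suc xs)) ₀ ≈ᴱ ∏ (map gen xs)
    ∏gen-suc-₀ []       S = refl
    ∏gen-suc-₀ (x ∷ xs) S = ∧-congˡ (∏gen-suc-₀ xs) S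

    ∏gen-suc-₁ : (xs : List (Fin n)) → ∏ (map gen (map suc xs)) ₁ ≈ᴱ 0ᴱ
    ∏gen-suc-₁ []       S = refl
    ∏gen-suc-₁ (x ∷ xs) S = begin
      (0ᴱ ∧ ∏ (map gen (map suc xs)) ₀) S + (inv (gen x) ∧ ∏ (map gen (map suc xs)) ₁) S
        ≈⟨ +-cong (∧-zeroˡ (∏ (map gen (map suc xs)) ₀) S)
                  (trans (∧-congˡ (∏gen-suc-₁ xs) S) (∧-zeroʳ (inv (gen x)) S)) ⟩
      0# + 0# ≈⟨ +-identityˡ _ ⟩
      0#      ∎

  e≈basis : (S : Subset n) → e S ≈ᴱ basis S
  e≈basis []            []            = refl
  e≈basis (outside ∷ S) T rewrite elements-∷ outside S with T
  ... | outside ∷ T′ = trans (∏gen-suc-₀ (elements S) T′) (e≈basis S T′)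
  ... | inside  ∷ T′ = ∏gen-suc-₁ (elements S) T′
  e≈basis (inside  ∷ S) T rewrite elements-∷ inside S with T
  ... | outside ∷ T′ = ∧-zeroˡ (∏ (map gen (map suc (elements S))) ₀) T′
  ... | inside  ∷ T′ = begin
    (1ᴱ ∧ y ₀) T′ + (inv 0ᴱ ∧ y ₁) T′
      ≈⟨ +-cong (∧-identityˡ (y ₀) T′) (trans (∧-congʳ inv-0 T′) (∧-zeroˡ (y ₁) T′)) ⟩
    y (outside ∷ T′) + 0# ≈⟨ +-identityʳ _ ⟩
    y (outside ∷ T′)      ≈⟨ ∏gen-suc-₀ (elements S) T′ ⟩
    e S T′                ≈⟨ e≈basis S T′ ⟩
    basis S T′            ∎
    where
    y : E _
    y = ∏ (map gen (map suc (elements S)))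

  ∂-cong : {a b : E n} → a ≈ᴱ b → ∂ a ≈ᴱ ∂ b
  ∂-cong {zero}  p []            = refl
  ∂-cong {suc n} p (outside ∷ S) = +-cong (∂-cong (p ∘ (outside ∷_)) S) (p (inside ∷ S))
  ∂-cong {suc n} p (inside  ∷ S) = -‿cong (∂-cong (p ∘ (inside ∷_)) S)

  ∂-+ : (a b : E n) → ∂ (a +ᴱ b) ≈ᴱ ∂ a +ᴱ ∂ b
  ∂-+ {zero}  a b []            = sym (+-identityˡ 0#)
  ∂-+ {suc n} a b (outside ∷ S) = trans (+-congʳ (∂-+ (a ₀) (b ₀) S)) (+ₚ.interchange _ _ _ _)
  ∂-+ {suc n} a b (inside  ∷ S) = trans (-‿cong (∂-+ (a ₁) (b ₁) S)) (sym (-‿+-comm _ _))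

  ∂-· : ∀ r (a : E n) → ∂ (r · a) ≈ᴱ r · ∂ a
  ∂-· {zero}  r a []            = sym (zeroʳ r)
  ∂-· {suc n} r a (outside ∷ S) = trans (+-congʳ (∂-· r (a ₀) S)) (sym (distribˡ _ _ _))
  ∂-· {suc n} r a (inside  ∷ S) = trans (-‿cong (∂-· r (a ₁) S)) (-‿distribʳ-* _ _)

  ∂-neg : (a : E n) → ∂ (-ᴱ a) ≈ᴱ -ᴱ ∂ a
  ∂-neg a S = trans (∂-cong (λ T → sym (-1*x≈-x (a T))) S) (trans (∂-· (- 1#) a S) (-1*x≈-x _))

  ∂-degree₀ : {a : E n} → Homogeneous 0 a → ∂ a ≈ᴱ 0ᴱ
  ∂-degree₀ {zero}  hom []            = refl
  ∂-degree₀ {suc n} hom (outside ∷ S) = trans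
    (+-cong (∂-degree₀ (homogeneous-₀ 0 hom) S) (hom (inside ∷ S) λ ())) (+-identityˡ 0#)
  ∂-degree₀ {suc n} hom (inside  ∷ S) = trans
    (-‿cong (∂-degree₀ (λ T _ → hom (inside ∷ T) λ ()) S)) -0#≈0#

  ∂-degree : ∀ p {a : E n} → Homogeneous (suc p) a → Homogeneous p (∂ a)
  ∂-degree {zero}  p hom []            _ = refl
  ∂-degree {suc n} p hom (outside ∷ S) ∣S∣≢p = trans
    (+-cong (∂-degree p (homogeneous-₀ (suc p) hom) S ∣S∣≢p)
            (homogeneous-₁ p hom S ∣S∣≢p))
    (+-identityˡ 0#)
  ∂-degree {suc n} zero    hom (inside ∷ S) _ = trans
    (-‿cong (∂-degree₀ (homogeneous-₁ 0 hom) S)) -0#≈0#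
  ∂-degree {suc n} (suc p) hom (inside ∷ S) ∣S∣≢p = trans
    (-‿cong (∂-degree p (homogeneous-₁ (suc p) hom) S (∣S∣≢p ∘ ≡.cong suc))) -0#≈0#

  ∂-0 : ∂ {n} 0ᴱ ≈ᴱ 0ᴱ
  ∂-0 = ∂-degree₀ λ _ _ → refl

  ∂-1 : ∂ {n} 1ᴱ ≈ᴱ 0ᴱ
  ∂-1 {n} = ∂-degree₀ (1-homogeneous {n})

  ∂-gen : (i : Fin n) → ∂ (gen i) ≈ᴱ 1ᴱ
  ∂-gen zero    (outside ∷ S) = trans (+-congʳ (∂-0 S)) (+-identityˡ _)
  ∂-gen zero    (inside  ∷ S) = trans (-‿cong (∂-1 S)) -0#≈0#
  ∂-gen (suc i) (outside ∷ S) = trans (+-identityʳ _) (∂-gen i S)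
  ∂-gen (suc i) (inside  ∷ S) = trans (-‿cong (∂-0 S)) -0#≈0#

  ∂-inv : (a : E n) → ∂ (inv a) ≈ᴱ -ᴱ inv (∂ a)
  ∂-inv {zero}  a []            = sym (trans (-‿cong (zeroʳ _)) -0#≈0#)
  ∂-inv {suc n} a (outside ∷ S) = begin
    ∂ (inv (a ₀)) S + inv a (inside ∷ S)     ≈⟨ +-cong (∂-inv (a ₀) S) (inv-₁ a S) ⟩
    - inv (∂ (a ₀)) S + - inv (a ₁) S        ≈⟨ -‿+-comm _ _ ⟩
    - (inv (∂ (a ₀)) S + inv (a ₁) S)        ≈⟨ -‿cong (distribˡ _ _ _) ⟨
    - inv (∂ a) (outside ∷ S)                ∎
  ∂-inv {suc n} a (inside  ∷ S) = -‿cong (begin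
    ∂ (inv a ₁) S           ≈⟨ ∂-cong (inv-₁ a) S ⟩
    ∂ (-ᴱ inv (a ₁)) S      ≈⟨ ∂-neg (inv (a ₁)) S ⟩
    - ∂ (inv (a ₁)) S       ≈⟨ -‿cong (∂-inv (a ₁) S) ⟩
    - - inv (∂ (a ₁)) S     ≈⟨ -‿cong (inv-neg (∂ (a ₁)) S) ⟨
    - inv (∂ a ₁) S         ≈⟨ inv-₁ (∂ a) S ⟨
    inv (∂ a) (inside ∷ S)  ∎)

  ∂-∧ : (a b : E n) → ∂ (a ∧ b) ≈ᴱ (∂ a ∧ b) +ᴱ (inv a ∧ ∂ b)
  ∂-∧ {zero}  a b []            = sym (trans (+-cong (zeroˡ _) (zeroʳ _)) (+-identityˡ 0#))
  ∂-∧ {suc n} a b (outside ∷ S) = begin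
    ∂ (a ₀ ∧ b ₀) S + ((a ₁ ∧ b ₀) S + (inv (a ₀) ∧ b ₁) S)
      ≈⟨ +-congʳ (∂-∧ (a ₀) (b ₀) S) ⟩
    ((∂ (a ₀) ∧ b ₀) S + (inv (a ₀) ∧ ∂ (b ₀)) S) + ((a ₁ ∧ b ₀) S + (inv (a ₀) ∧ b ₁) S)
      ≈⟨ +ₚ.interchange _ _ _ _ ⟩
    ((∂ (a ₀) ∧ b ₀) S + (a ₁ ∧ b ₀) S) + ((inv (a ₀) ∧ ∂ (b ₀)) S + (inv (a ₀) ∧ b ₁) S)
      ≈⟨ +-cong (∧-distribʳ (b ₀) (∂ (a ₀)) (a ₁) S) (∧-distribˡ (inv (a ₀)) (∂ (b ₀)) (b ₁) S) ⟨
    ((∂ (a ₀) +ᴱ a ₁) ∧ b ₀) S + (inv (a ₀) ∧ (∂ (b ₀) +ᴱ b ₁)) S ∎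
  ∂-∧ {suc n} a b (inside  ∷ S) = begin
    - ∂ ((a ₁ ∧ b ₀) +ᴱ (inv (a ₀) ∧ b ₁)) S
      ≈⟨ -‿cong (∂-+ (a ₁ ∧ b ₀) (inv (a ₀) ∧ b ₁) S) ⟩
    - (∂ (a ₁ ∧ b ₀) S + ∂ (inv (a ₀) ∧ b ₁) S)
      ≈⟨ -‿+-comm _ _ ⟨
    - ∂ (a ₁ ∧ b ₀) S + - ∂ (inv (a ₀) ∧ b ₁) S
      ≈⟨ +-cong lhs₁ lhs₂ ⟩
    (p + q) + (u + v)
      ≈⟨ +-congʳ (+-congˡ (+-identityʳ q)) ⟨
    (p + (q + 0#)) + (u + v)
      ≈⟨ +-congʳ (+-congˡ (+-congˡ (-‿inverseʳ w))) ⟨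
    (p + (q + (w + - w))) + (u + v)
      ≈⟨ shuffle ⟩
    (p + (u + w)) + ((- w + q) + v)
      ≈⟨ +-cong (+-congˡ rhs₁) (+-congʳ rhs₂) ⟨
    ((∂ a ₁ ∧ b ₀) S + (inv (∂ a ₀) ∧ b ₁) S) + ((inv a ₁ ∧ ∂ b ₀) S + v)
      ∎
    where
    p q u v w : Carrier
    p = ((-ᴱ ∂ (a ₁)) ∧ b ₀) S
    q = - (inv (a ₁) ∧ ∂ (b ₀)) S
    u = (inv (∂ (a ₀)) ∧ b ₁) S
    v = (inv (inv (a ₀)) ∧ (-ᴱ ∂ (b ₁))) S
    w = (inv (a ₁) ∧ b ₁) S

    lhs₁ : - ∂ (a ₁ ∧ b ₀) S ≈ p + q
    lhs₁ = begin
      - ∂ (a ₁ ∧ b ₀) S                                     ≈⟨ -‿cong (∂-∧ (a ₁) (b ₀) S) ⟩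
      - ((∂ (a ₁) ∧ b ₀) S + (inv (a ₁) ∧ ∂ (b ₀)) S)       ≈⟨ -‿+-comm _ _ ⟨
      - (∂ (a ₁) ∧ b ₀) S + q                               ≈⟨ +-congʳ (∧-negˡ (∂ (a ₁)) (b ₀) S) ⟨
      p + q                                                 ∎

    lhs₂ : - ∂ (inv (a ₀) ∧ b ₁) S ≈ u + v
    lhs₂ = begin
      - ∂ (inv (a ₀) ∧ b ₁) S
        ≈⟨ -‿cong (∂-∧ (inv (a ₀)) (b ₁) S) ⟩
      - ((∂ (inv (a ₀)) ∧ b ₁) S + (inv (inv (a ₀)) ∧ ∂ (b ₁)) S)
        ≈⟨ -‿+-comm _ _ ⟨
      - (∂ (inv (a ₀)) ∧ b ₁) S + - (inv (inv (a ₀)) ∧ ∂ (b ₁)) S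
        ≈⟨ +-cong (-‿cong (trans (∧-congʳ (∂-inv (a ₀)) S) (∧-negˡ (inv (∂ (a ₀))) (b ₁) S)))
                  (sym (∧-negʳ (inv (inv (a ₀))) (∂ (b ₁)) S)) ⟩
      - - u + v
        ≈⟨ +-congʳ (-‿involutive u) ⟩
      u + v ∎

    rhs₁ : (inv (∂ a ₀) ∧ b ₁) S ≈ u + w
    rhs₁ = trans (∧-congʳ (inv-+ (∂ (a ₀)) (a ₁)) S) (∧-distribʳ (b ₁) (inv (∂ (a ₀))) (inv (a ₁)) S)

    rhs₂ : (inv a ₁ ∧ ∂ b ₀) S ≈ - w + q
    rhs₂ = begin
      (inv a ₁ ∧ ∂ b ₀) S                                 ≈⟨ ∧-congʳ (inv-₁ a) S ⟩
      ((-ᴱ inv (a ₁)) ∧ (∂ (b ₀) +ᴱ b ₁)) S               ≈⟨ ∧-negˡ (inv (a ₁)) (∂ b ₀) S ⟩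
      - (inv (a ₁) ∧ (∂ (b ₀) +ᴱ b ₁)) S                  ≈⟨ -‿cong (∧-distribˡ (inv (a ₁)) (∂ (b ₀)) (b ₁) S) ⟩
      - ((inv (a ₁) ∧ ∂ (b ₀)) S + w)                     ≈⟨ -‿+-comm _ _ ⟨
      q + - w                                             ≈⟨ +-comm _ _ ⟩
      - w + q                                             ∎

    shuffle : (p + (q + (w + - w))) + (u + v) ≈ (p + (u + w)) + ((- w + q) + v)
    shuffle = begin
      (p + (q + (w + - w))) + (u + v)   ≈⟨ +-congʳ (+-congˡ (+-comm q _)) ⟩
      (p + ((w + - w) + q)) + (u + v)   ≈⟨ +-congʳ (+-congˡ (+-assoc _ _ _)) ⟩
      (p + (w + (- w + q))) + (u + v)   ≈⟨ +-congʳ (+-assoc _ _ _) ⟨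
      ((p + w) + (- w + q)) + (u + v)   ≈⟨ +ₚ.interchange _ _ _ _ ⟩
      ((p + w) + u) + ((- w + q) + v)   ≈⟨ +-congʳ (+-assoc _ _ _) ⟩
      (p + (w + u)) + ((- w + q) + v)   ≈⟨ +-congʳ (+-congˡ (+-comm w u)) ⟩
      (p + (u + w)) + ((- w + q) + v)   ∎

  ∂-isDifferential : IsDifferential (∂ {n})
  ∂-isDifferential = record
    { cong    = ∂-cong
    ; +-homo  = ∂-+
    ; ·-homo  = ∂-·
    ; degree  = ∂-degree
    ; degree₀ = ∂-degree₀
    ; gen↦1   = ∂-gen
    ; leibniz = λ p {a} hom b S → trans (∂-∧ a b S)
        (+-congˡ (trans (∧-congʳ (homogeneous⇒inv p hom) S) (·-∧ (sgn p) a (∂ b) S)))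
    }

  private
    combination : E n → List (Subset n) → E n
    combination a = foldr (λ S b → (a S · e S) +ᴱ b) 0ᴱ

    combination-++ : ∀ (a : E n) Ss Ts →
      combination a (Ss ++ Ts) ≈ᴱ combination a Ss +ᴱ combination a Ts
    combination-++ a []       Ts U = sym (+-identityˡ _)
    combination-++ a (S ∷ Ss) Ts U = trans (+-congˡ (combination-++ a Ss Ts U)) (sym (+-assoc _ _ _))

    combination-same : ∀ s (a : E (suc n)) Ss T →
      combination a (map (s ∷_) Ss) (s ∷ T) ≈ combination (a ∘ (s ∷_)) Ss T
    combination-same s a []       T = refl
    combination-same s a (S ∷ Ss) T = +-cong
      (*-congˡ (trans (e≈basis (s ∷ S) (s ∷ T)) (trans (same s) (sym (e≈basis S T)))))
      (combination-same s a Ss T)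
      where
      same : ∀ s → basis (s ∷ S) (s ∷ T) ≈ basis S T
      same inside  = refl
      same outside = refl

    combination-other : ∀ s t → s ≢ t → ∀ (a : E (suc n)) Ss T →
      combination a (map (s ∷_) Ss) (t ∷ T) ≈ 0#
    combination-other s t s≢t a []       T = refl
    combination-other s t s≢t a (S ∷ Ss) T = trans
      (+-cong (trans (*-congˡ (trans (e≈basis (s ∷ S) (t ∷ T)) (other s t s≢t))) (zeroʳ _))
              (combination-other s t s≢t a Ss T))
      (+-identityˡ _)
      where
      other : ∀ s t → s ≢ t → basis (s ∷ S) (t ∷ T) ≈ 0#
      other inside  inside  s≢t = contradiction ≡.refl s≢t
      other inside  outside s≢t = refl
      other outside inside  s≢t = refl
      other outside outside s≢t = contradiction ≡.refl s≢t

  expansion : (a : E n) → a ≈ᴱ foldr (λ S b → (a S · e S) +ᴱ b) 0ᴱ (subsets n)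
  expansion {zero}  a []            = sym (trans (+-identityʳ _) (*-identityʳ _))
  expansion {suc n} a (outside ∷ T) = begin
    a (outside ∷ T)                   ≈⟨ expansion (a ₀) T ⟩
    combination (a ₀) (subsets n) T   ≈⟨ +-identityʳ _ ⟨
    combination (a ₀) (subsets n) T + 0#
      ≈⟨ +-cong (combination-same outside a (subsets n) T)
                (combination-other inside outside (λ ()) a (subsets n) T) ⟨
    combination a (map (outside ∷_) (subsets n)) (outside ∷ T) +
      combination a (map (inside ∷_) (subsets n)) (outside ∷ T)
      ≈⟨ combination-++ a (map (outside ∷_) (subsets n)) (map (inside ∷_) (subsets n)) (outside ∷ T) ⟨
    combination a (subsets (suc n)) (outside ∷ T) ∎
  expansion {suc n} a (inside  ∷ T) = begin
    a (inside ∷ T)                    ≈⟨ expansion (a ₁) T ⟩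
    combination (a ₁) (subsets n) T   ≈⟨ +-identityˡ _ ⟨
    0# + combination (a ₁) (subsets n) T
      ≈⟨ +-cong (combination-other outside inside (λ ()) a (subsets n) T)
                (combination-same inside a (subsets n) T) ⟨
    combination a (map (outside ∷_) (subsets n)) (inside ∷ T) +
      combination a (map (inside ∷_) (subsets n)) (inside ∷ T)
      ≈⟨ combination-++ a (map (outside ∷_) (subsets n)) (map (inside ∷_) (subsets n)) (inside ∷ T) ⟨
    combination a (subsets (suc n)) (inside ∷ T) ∎

  ∂-unique : {D : E n → E n} → IsDifferential D → ∀ a → D a ≈ᴱ ∂ a
  ∂-unique {n} {D} isD a U = begin
    D a U                               ≈⟨ D′.cong (expansion a) U ⟩
    D (combination a (subsets n)) U     ≈⟨ onCombinations (subsets n) U ⟩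
    ∂ (combination a (subsets n)) U     ≈⟨ ∂-cong (expansion a) U ⟨
    ∂ a U                               ∎
    where
    module D′ = IsDifferential isD

    onProducts : ∀ xs → D (∏ (map gen xs)) ≈ᴱ ∂ (∏ (map gen xs))
    onProducts []       S = trans
      (D′.degree₀ (1-homogeneous {n}) S)
      (sym (∂-1 S))
    onProducts (x ∷ xs) S = begin
      D (gen x ∧ y) S
        ≈⟨ D′.leibniz 1 (gen-homogeneous x) y S ⟩
      (D (gen x) ∧ y) S + sgn 1 * (gen x ∧ D y) S
        ≈⟨ +-cong (∧-congʳ (λ T → trans (D′.gen↦1 x T) (sym (∂-gen x T))) S)
                  (*-congˡ (∧-congˡ (onProducts xs) S)) ⟩
      (∂ (gen x) ∧ y) S + sgn 1 * (gen x ∧ ∂ y) S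
        ≈⟨ IsDifferential.leibniz ∂-isDifferential 1 (gen-homogeneous x) y S ⟨
      ∂ (gen x ∧ y) S ∎
      where
      y : E n
      y = ∏ (map gen xs)

    onCombinations : ∀ Ss → D (combination a Ss) ≈ᴱ ∂ (combination a Ss)
    onCombinations []       S = trans (D′.degree₀ (λ _ _ → refl) S) (sym (∂-0 S))
    onCombinations (T ∷ Ts) S = begin
      D ((a T · e T) +ᴱ combination a Ts) S
        ≈⟨ D′.+-homo (a T · e T) (combination a Ts) S ⟩
      D (a T · e T) S + D (combination a Ts) S
        ≈⟨ +-cong (D′.·-homo (a T) (e T) S) (onCombinations Ts S) ⟩
      a T * D (e T) S + ∂ (combination a Ts) S
        ≈⟨ +-congʳ (*-congˡ (onProducts (elements T) S)) ⟩
      a T * ∂ (e T) S + ∂ (combination a Ts) S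
        ≈⟨ +-congʳ (∂-· (a T) (e T) S) ⟨
      ∂ (a T · e T) S + ∂ (combination a Ts) S
        ≈⟨ ∂-+ (a T · e T) (combination a Ts) S ⟨
      ∂ ((a T · e T) +ᴱ combination a Ts) S ∎

  module OrlikSolomon {n : ℕ} (M : Matroid n) where
    open Matroid M

    infix 4 _∈I _∈I⁰

    -- The two-sided ideal generated by the ∂ e_S with S dependent.
    data _∈I : E n → Set (c ⊔ˡ ℓ) where
      generator : ∀ S → Dependent S → ∂ (e S) ∈I
      resp      : ∀ {a b} → a ≈ᴱ b → a ∈I → b ∈I
      zero∈     : 0ᴱ ∈I
      add∈      : ∀ {a b} → a ∈I → b ∈I → a +ᴱ b ∈I
      left∈     : ∀ a {b} → b ∈I → a ∧ b ∈I
      right∈    : ∀ {a} b → a ∈I → a ∧ b ∈I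

    _∈I⁰ : E n → Set (c ⊔ˡ ℓ)
    a ∈I⁰ = ∀ b → b ∈I → a ∧ b ≈ᴱ 0ᴱ

    I⁰-component : ℕ → Pred (E n) (c ⊔ˡ ℓ)
    I⁰-component d a = a ∈I⁰ × Homogeneous d a

    module _ (T : Subset n) where

      X : ℕ → Subset n
      X zero    = Subset.⊥
      X (suc q) = cl (fromList (drop (∣ T ∣ ∸ suc q) (elements T)))

      -- block q is S_{q+1} = X_{q+1} \ X_q.
      block : ℕ → Subset n
      block q = X (suc q) ─ X q

      blocks : List (Subset n)
      blocks = map block (upTo ∣ T ∣)

      rest : Subset n
      rest = ∁ (X ∣ T ∣)

      σ : List (Fin n)
      σ = concatMap elements blocks ++ elements rest

      z : E n
      z = sgn (inversions σ) · (∏ (map (∂ ∘ e) blocks) ∧ e rest)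

{-# OPTIONS --safe #-}

-- Write ψ_S(a) for the coefficient of e_[n] in a e_S; signs are never tracked, only that they are ±1.
-- If S meets some block S_q of T twice then ∂e_{S_q} kills both e_S and ∂e_S; if S meets [n] ∖ X_p
-- twice then the last factor of z(T) kills ∂e_S; and a set meeting each of these at most once is
-- independent. Hence z(T) annihilates I. Since T is nbc, each i_{p-q+1} is the least element of X_q,
-- so an nbc-set of size p meeting each block once contains all of these, i.e. equals T; as
-- eᵢ ∂e_B = e_B for i ∈ B, ψ_T(z(T)) = ±1. So ψ_S(z(T)) = ±δ_{S,T} on nbc-sets of size p, which gives
-- independence. Conversely, nbc-monomials span E modulo I, so an element of (I⁰)_{n-p} on which all
-- these ψ_S vanish is 0, because the pairing is perfect.
module Submission where

import Algebra.Properties.CommutativeSemigroup as CommutativeSemigroupProperties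
import Algebra.Properties.Ring as RingProperties
import Algebra.Properties.Semiring.Exp as Exp
open import Algebra.Bundles using (CommutativeRing)
open import Data.Bool.Base using (if_then_else_)
open import Data.Empty using (⊥-elim)
open import Data.Fin.Base as Fin using (Fin; zero; suc)
import Data.Fin.Properties as Fin
open import Data.Fin.Subset
  using (Subset; inside; outside; ⊤; ⊥; _∈_; _∉_; _⊆_; _⊂_; _∪_; _∩_; _─_; _-_; ∁; ⁅_⁆; ∣_∣; Nonempty)
open import Data.Fin.Subset.Properties
open import Data.List.Base
  using (List; []; _∷_; _++_; _∷ʳ_; map; foldr; length; drop; lookup; upTo; allFin)
open import Data.List.Membership.Propositional using () renaming (_∈_ to _∈ˡ_)
open import Data.List.Membership.Propositional.Properties
  using (∈-filter⁺; ∈-filter⁻; ∈-map⁺; ∈-map⁻; ∈-++⁺ˡ; ∈-++⁺ʳ; ∈-allFin; ∈-lookup)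
import Data.List.Properties as List
open import Data.List.Relation.Unary.All as All using (All; []; _∷_)
import Data.List.Relation.Unary.All.Properties as All
open import Data.List.Relation.Unary.AllPairs using (AllPairs; []; _∷_)
import Data.List.Relation.Unary.AllPairs.Properties as AllPairs
open import Data.List.Relation.Unary.Any as Any using (here; there)
import Data.List.Relation.Unary.Any.Properties as Any
open import Data.List.Relation.Unary.Unique.Propositional using (Unique)
import Data.List.Relation.Unary.Unique.Propositional.Properties as Unique
open import Data.Nat.Base as ℕ using (ℕ; zero; suc; _≤_; _∸_; _⊔_; z≤n; s≤s)
open import Data.Nat.Induction using (<-wellFounded)
import Data.Nat.Properties as ℕ
open import Data.Product.Base using (_×_; _,_; proj₁; proj₂; ∃; ∃-syntax)
open import Data.Sum.Base using (_⊎_; inj₁; inj₂; [_,_]′)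
open import Data.Vec.Base using ([]; _∷_; here; there)
import Data.Vec.Properties as Vec
open import Function.Base using (_∘_; id)
open import Induction.WellFounded using (Acc; acc)
open import Relation.Binary.Bundles using (Setoid)
open import Relation.Binary.PropositionalEquality as ≡ using (_≡_; _≢_)
import Relation.Binary.Reasoning.Setoid as SetoidReasoning
open import Relation.Nullary using (¬_; Dec; yes; no; contradiction; does; ¬?; _×-dec_)
open import Relation.Nullary.Decidable using (dec-true)
open import Defs

-- The quotient of `E` by `I` is never formed. That nbc-monomials span it is used in dual form: for
-- a fixed `b` in the annihilator, `b ∧ e S` has zero top coefficient for every `S` as soon as this
-- holds for the nbc-sets. A broken circuit inside `S` is traded for sets that gain the missing
-- least element of the circuit, and the process terminates because these sets are lexicographically
-- earlier. Sets whose size differs from `p` pair to zero with `b` for degree reasons, so only the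
-- nbc-sets of size `p` have to be checked. No division occurs over the arbitrary ring: the matrix
-- of pairings between the `z(T)` and the nbc-monomials of size `p` is diagonal with entries ±1, so
-- the coordinates of an element are its pairings up to sign. The flats `X_q` are the closures of
-- the suffixes of the increasing list of `T`. Statements about `z(T)` are therefore proved by
-- induction on that list, each new head being the smallest element so far and contributing the
-- outermost block.

private
  variable
    n : ℕ

-- Finite subsets: cardinality, enumeration and a lexicographic weight

∣p∪⁅x⁆∣≡1+∣p∣ : ∀ {p : Subset n} {x} → x ∉ p → ∣ p ∪ ⁅ x ⁆ ∣ ≡ suc ∣ p ∣
∣p∪⁅x⁆∣≡1+∣p∣ {p = inside  ∷ p} {zero}  x∉p = contradiction here x∉p
∣p∪⁅x⁆∣≡1+∣p∣ {p = outside ∷ p} {zero}  x∉p = ≡.cong (suc ∘ ∣_∣) (∪-identityʳ p)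
∣p∪⁅x⁆∣≡1+∣p∣ {p = inside  ∷ p} {suc x} x∉p = ≡.cong suc (∣p∪⁅x⁆∣≡1+∣p∣ (x∉p ∘ there))
∣p∪⁅x⁆∣≡1+∣p∣ {p = outside ∷ p} {suc x} x∉p = ∣p∪⁅x⁆∣≡1+∣p∣ (x∉p ∘ there)

x∉p─q : ∀ (p : Subset n) {q x} → x ∈ q → x ∉ p ─ q
x∉p─q (_ ∷ p) {inside ∷ q}  (here)      ()
x∉p─q (_ ∷ p) {_ ∷ q}       (there x∈q) (there x∈p─q) = x∉p─q p x∈q x∈p─q

∈∪-caseʳ : ∀ {p q r : Subset n} → p ⊆ r → q ⊆ r → p ∪ q ⊆ r
∈∪-caseʳ {p = p} {q} p⊆r q⊆r = [ p⊆r , q⊆r ]′ ∘ x∈p∪q⁻ p q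

⁅x⁆⊆ : ∀ {p : Subset n} {x} → x ∈ p → ⁅ x ⁆ ⊆ p
⁅x⁆⊆ {x = x} x∈p y∈⁅x⁆ rewrite x∈⁅y⁆⇒x≡y x y∈⁅x⁆ = x∈p

x∈p∪⁅x⁆ : ∀ (p : Subset n) x → x ∈ p ∪ ⁅ x ⁆
x∈p∪⁅x⁆ p x = q⊆p∪q p ⁅ x ⁆ (x∈⁅x⁆ x)

p⊆q∪⁅x⁆∧x∉p⇒p⊆q : ∀ {p q : Subset n} {x} → p ⊆ q ∪ ⁅ x ⁆ → x ∉ p → p ⊆ q
p⊆q∪⁅x⁆∧x∉p⇒p⊆q {q = q} {x} p⊆ x∉p y∈p with x∈p∪q⁻ q ⁅ x ⁆ (p⊆ y∈p)
... | inj₁ y∈q = y∈q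
... | inj₂ y∈x = contradiction (≡.subst (_∈ _) (x∈⁅y⁆⇒x≡y x y∈x) y∈p) x∉p

p⊆q∪⁅x⁆⇒p-x⊆q : ∀ {p q : Subset n} {x} → p ⊆ q ∪ ⁅ x ⁆ → p - x ⊆ q
p⊆q∪⁅x⁆⇒p-x⊆q {p = p} {q} {x} p⊆ =
  p⊆q∪⁅x⁆∧x∉p⇒p⊆q (λ {y} → p⊆ {y} ∘ p─q⊆p p ⁅ x ⁆ {y}) (x∉p─q p (x∈⁅x⁆ x))

p⊆q∧∣q∣≤∣p∣⇒q⊆p : ∀ {p q : Subset n} → p ⊆ q → ∣ q ∣ ≤ ∣ p ∣ → q ⊆ p
p⊆q∧∣q∣≤∣p∣⇒q⊆p {p = p} p⊆q ∣q∣≤∣p∣ {x} x∈q with x ∈? p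
... | yes x∈p = x∈p
... | no  x∉p = contradiction ∣q∣≤∣p∣ (ℕ.<⇒≱ (p⊂q⇒∣p∣<∣q∣ (p⊆q , x , x∈q , x∉p)))

∣q∣≡∣p∣+∣q─p∣ : ∀ {p q : Subset n} → p ⊆ q → ∣ q ∣ ≡ ∣ p ∣ ℕ.+ ∣ q ─ p ∣
∣q∣≡∣p∣+∣q─p∣ {p = []}          {[]}          p⊆q = ≡.refl
∣q∣≡∣p∣+∣q─p∣ {p = inside  ∷ p} {inside  ∷ q} p⊆q = ≡.cong suc (∣q∣≡∣p∣+∣q─p∣ (drop-∷-⊆ p⊆q))
∣q∣≡∣p∣+∣q─p∣ {p = inside  ∷ p} {outside ∷ q} p⊆q with () ← p⊆q here
∣q∣≡∣p∣+∣q─p∣ {p = outside ∷ p} {inside  ∷ q} p⊆q =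
  ≡.trans (≡.cong suc (∣q∣≡∣p∣+∣q─p∣ (drop-∷-⊆ p⊆q))) (≡.sym (ℕ.+-suc _ _))
∣q∣≡∣p∣+∣q─p∣ {p = outside ∷ p} {outside ∷ q} p⊆q = ∣q∣≡∣p∣+∣q─p∣ (drop-∷-⊆ p⊆q)

subsets-complete : (S : Subset n) → S ∈ˡ subsets n
subsets-complete []            = here ≡.refl
subsets-complete (outside ∷ S) = ∈-++⁺ˡ (∈-map⁺ (outside ∷_) (subsets-complete S))
subsets-complete (inside  ∷ S) = ∈-++⁺ʳ (map (outside ∷_) (subsets _)) (∈-map⁺ (inside ∷_) (subsets-complete S))

lookup-injective : ∀ {a} {A : Set a} {xs : List A} → Unique xs → ∀ i j → lookup xs i ≡ lookup xs j → i ≡ j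
lookup-injective (_ ∷ _)    zero    zero    _  = ≡.refl
lookup-injective (x∉ ∷ _)   zero    (suc j) eq = contradiction eq (All.lookup x∉ (∈-lookup j))
lookup-injective (x∉ ∷ _)   (suc i) zero    eq = contradiction (≡.sym eq) (All.lookup x∉ (∈-lookup i))
lookup-injective (_ ∷ uniq) (suc i) (suc j) eq = ≡.cong suc (lookup-injective uniq i j eq)

subsets-unique : ∀ n → Unique (subsets n)
subsets-unique zero    = [] ∷ []
subsets-unique (suc n) = Unique.++⁺
  (Unique.map⁺ Vec.∷-injectiveʳ (subsets-unique n)) (Unique.map⁺ Vec.∷-injectiveʳ (subsets-unique n))
  λ (S∈out , S∈in) → let _ , _ , S≡out = ∈-map⁻ (outside ∷_) S∈out
                         _ , _ , S≡in  = ∈-map⁻ (inside ∷_) S∈in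
                     in case-⊥ (≡.trans (≡.sym S≡out) S≡in)
  where
  case-⊥ : ∀ {S T : Subset n} → outside ∷ S ≢ inside ∷ T
  case-⊥ ()

-- S read as a binary number, most significant digit first, with outside as 1.
weight : Subset n → ℕ
weight []                    = 0
weight {suc n} (outside ∷ S) = 2 ℕ.^ n ℕ.+ weight S
weight         (inside  ∷ S) = weight S

weight-< : (S : Subset n) → weight S ℕ.< 2 ℕ.^ n
weight-< []                    = s≤s z≤n
weight-< {suc n} (outside ∷ S) = ℕ.+-monoʳ-< (2 ℕ.^ n) (ℕ.≤-trans (weight-< S) (ℕ.m≤m+n _ 0))
weight-< {suc n} (inside  ∷ S) = ℕ.≤-trans (weight-< S) (ℕ.m≤m+n _ _)

-- The digit at `i` drops from 1 to 0 and no more significant digit grows; by `weight-<` the less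
-- significant digits cannot make up for this.
weight-decreases : ∀ {i} {S S′ : Subset n} → i ∈ S′ → i ∉ S →
                   (∀ {k} → k Fin.< i → k ∈ S → k ∈ S′) → weight S′ ℕ.< weight S
weight-decreases {S = inside  ∷ S} here i∉S below = contradiction here i∉S
weight-decreases {S = outside ∷ S} {inside ∷ S′} here i∉S below = ℕ.≤-trans (weight-< S′) (ℕ.m≤m+n _ _)
weight-decreases {n = suc n} {suc i} {s ∷ S} {s′ ∷ S′} (there i∈S′) i∉S below = go s s′ (below {zero} (s≤s z≤n))
  where
  tail-decreases : weight S′ ℕ.< weight S
  tail-decreases = weight-decreases i∈S′ (i∉S ∘ there) λ k<i k∈S → drop-there (below (s≤s k<i) (there k∈S))

  go : ∀ s s′ → (zero ∈ s ∷ S → zero ∈ s′ ∷ S′) → weight (s′ ∷ S′) ℕ.< weight (s ∷ S)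
  go inside  inside  head = tail-decreases
  go inside  outside head with () ← head here
  go outside inside  head = ℕ.≤-trans tail-decreases (ℕ.m≤n+m _ (2 ℕ.^ n))
  go outside outside head = ℕ.+-monoʳ-< (2 ℕ.^ n) tail-decreases

-- Sets that meet a block at least twice

-- Two common elements are what a boundary calls for: every monomial of `∂ (e B)` omits one element
-- of `B`, and a common element with `S` is still left.
Crowds : Subset n → Subset n → Set
Crowds S B = ∃[ x ] ∃[ y ] x ≢ y × (x ∈ S × x ∈ B) × (y ∈ S × y ∈ B)

crowds? : (S B : Subset n) → Dec (Crowds S B)
crowds? S B = Fin.any? λ x → Fin.any? λ y →
  ¬? (x Fin.≟ y) ×-dec ((x ∈? S) ×-dec (x ∈? B)) ×-dec ((y ∈? S) ×-dec (y ∈? B))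

-- `B` is only asked to contain the difference of `Y` and `X`, so that one lemma serves both the
-- layers and, with `Y` the full set, the complement of the last flat.
uncrowded : ∀ {S X Y B : Subset n} → (∀ {x} → x ∈ Y → x ∉ X → x ∈ B) → ¬ Crowds S B →
            S ∩ Y ⊆ S ∩ X ⊎ ∃[ x ] (x ∈ Y × x ∉ X × S ∩ Y ⊆ S ∩ X ∪ ⁅ x ⁆)
uncrowded {S = S} {X} {Y} Y─X⊆B ¬crowds with Fin.any? (λ x → (x ∈? S) ×-dec (x ∈? Y) ×-dec ¬? (x ∈? X))
... | no ∄x = inj₁ λ {y} y∈S∩Y → let y∈S , y∈Y = x∈p∩q⁻ S Y y∈S∩Y in go y y∈S y∈Y
  where
  go : ∀ y → y ∈ S → y ∈ Y → y ∈ S ∩ X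
  go y y∈S y∈Y with y ∈? X
  ... | yes y∈X = x∈p∩q⁺ (y∈S , y∈X)
  ... | no  y∉X = contradiction (y , y∈S , y∈Y , y∉X) ∄x
... | yes (x , x∈S , x∈Y , x∉X) = inj₂ (x , x∈Y , x∉X , λ {y} y∈S∩Y →
        let y∈S , y∈Y = x∈p∩q⁻ S Y y∈S∩Y in go y y∈S y∈Y)
  where
  go : ∀ y → y ∈ S → y ∈ Y → y ∈ S ∩ X ∪ ⁅ x ⁆
  go y y∈S y∈Y with y ∈? X
  ... | yes y∈X = p⊆p∪q ⁅ x ⁆ (x∈p∩q⁺ (y∈S , y∈X))
  ... | no  y∉X with x Fin.≟ y
  ...   | yes ≡.refl = x∈p∪⁅x⁆ (S ∩ X) x
  ...   | no  x≢y    = contradiction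
            (x , y , x≢y , (x∈S , Y─X⊆B x∈Y x∉X) , (y∈S , Y─X⊆B y∈Y y∉X)) ¬crowds

∣S∩Y∣≤1+∣S∩X∣ : ∀ {S X Y : Subset n} → ¬ Crowds S (Y ─ X) → ∣ S ∩ Y ∣ ≤ suc ∣ S ∩ X ∣
∣S∩Y∣≤1+∣S∩X∣ {S = S} {X} ¬crowds with uncrowded {S = S} {X} x∈p∧x∉q⇒x∈p─q ¬crowds
... | inj₁ S∩Y⊆S∩X = ℕ.m≤n⇒m≤1+n (p⊆q⇒∣p∣≤∣q∣ S∩Y⊆S∩X)
... | inj₂ (x , _ , x∉X , S∩Y⊆) = ℕ.≤-trans (p⊆q⇒∣p∣≤∣q∣ S∩Y⊆)
        (ℕ.≤-reflexive (∣p∪⁅x⁆∣≡1+∣p∣ (x∉X ∘ proj₂ ∘ x∈p∩q⁻ S X)))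

-- Increasing lists and the subsets they enumerate

Sorted : List (Fin n) → Set
Sorted = AllPairs Fin._<_

∈-fromList⁺ : ∀ {x} {xs : List (Fin n)} → x ∈ˡ xs → x ∈ fromList xs
∈-fromList⁺ {x = x} {y ∷ xs} (here ≡.refl) = p⊆p∪q (fromList xs) (x∈⁅x⁆ x)
∈-fromList⁺ {xs = y ∷ xs}    (there x∈xs)  = q⊆p∪q ⁅ y ⁆ (fromList xs) (∈-fromList⁺ x∈xs)

∈-fromList⁻ : ∀ {x} (xs : List (Fin n)) → x ∈ fromList xs → x ∈ˡ xs
∈-fromList⁻ []       x∈ = contradiction x∈ ∉⊥
∈-fromList⁻ (y ∷ xs) x∈ with x∈p∪q⁻ ⁅ y ⁆ (fromList xs) x∈
... | inj₁ x∈⁅y⁆ = here (x∈⁅y⁆⇒x≡y y x∈⁅y⁆)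
... | inj₂ x∈xs  = there (∈-fromList⁻ xs x∈xs)

fromList-∷ : ∀ x (xs : List (Fin n)) → fromList (x ∷ xs) ≡ fromList xs ∪ ⁅ x ⁆
fromList-∷ x xs = ∪-comm ⁅ x ⁆ (fromList xs)

sorted⇒∉ : ∀ {x} {xs : List (Fin n)} → Sorted (x ∷ xs) → x ∉ fromList xs
sorted⇒∉ {xs = xs} (x< ∷ _) x∈xs = Fin.<-irrefl ≡.refl (All.lookup x< (∈-fromList⁻ xs x∈xs))

∣fromList∣≡length : ∀ {xs : List (Fin n)} → Sorted xs → ∣ fromList xs ∣ ≡ length xs
∣fromList∣≡length {n} {[]}     []             = ∣⊥∣≡0 n
∣fromList∣≡length {xs = x ∷ xs} sorted@(_ ∷ sorted-xs) = ≡.trans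
  (≡.cong ∣_∣ (fromList-∷ x xs))
  (≡.trans (∣p∪⁅x⁆∣≡1+∣p∣ (sorted⇒∉ sorted)) (≡.cong suc (∣fromList∣≡length sorted-xs)))

elements-sorted : (S : Subset n) → Sorted (elements S)
elements-sorted S = AllPairs.filter⁺ (_∈? S) (AllPairs.tabulate⁺-< id)

fromList-elements : (S : Subset n) → fromList (elements S) ≡ S
fromList-elements S = ⊆-antisym
  (λ {x} → proj₂ ∘ ∈-filter⁻ (_∈? S) {xs = allFin _} ∘ ∈-fromList⁻ (elements S))
  (λ {x} x∈S → ∈-fromList⁺ (∈-filter⁺ (_∈? S) (∈-allFin x) x∈S))

length-elements : (S : Subset n) → length (elements S) ≡ ∣ S ∣
length-elements S = ≡.trans (≡.sym (∣fromList∣≡length (elements-sorted S))) (≡.cong ∣_∣ (fromList-elements S))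

max-≤ : ∀ {k ms} → All (_≤ k) ms → foldr _⊔_ 0 ms ≤ k
max-≤ []         = z≤n
max-≤ (m≤k ∷ ms) = ℕ.⊔-lub m≤k (max-≤ ms)

≤-max : ∀ {m ms} → m ∈ˡ ms → m ≤ foldr _⊔_ 0 ms
≤-max (here ≡.refl) = ℕ.m≤m⊔n _ _
≤-max (there m∈ms)  = ℕ.≤-trans (≤-max m∈ms) (ℕ.m≤n⊔m _ _)

-- Matroids: rank, closure and exchange

module MatroidProperties {n : ℕ} (M : Matroid n) where
  open Matroid M

  simple⇒indep : Simple → ∀ i → Indep ⁅ i ⁆
  simple⇒indep (no-loops , _) i with indep? ⁅ i ⁆
  ... | yes indep = indep
  ... | no  dep   = contradiction (dep , proper) (no-loops i)
    where
    proper : ∀ A → A ⊂ ⁅ i ⁆ → Indep A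
    proper A (A⊆ , x , x∈ , x∉A) rewrite x∈⁅y⁆⇒x≡y i x∈ = ≡.subst Indep (≡.sym (Empty-unique
      (λ (y , y∈A) → x∉A (≡.subst (_∈ A) (x∈⁅y⁆⇒x≡y i (A⊆ y∈A)) y∈A)))) ∅-indep

  rank-≤ : ∀ {k} S → (∀ A → A ⊆ S → Indep A → ∣ A ∣ ≤ k) → rank S ≤ k
  rank-≤ S bound = max-≤ (All.map⁺ (All.map (λ {A} (A⊆S , A-indep) → bound A A⊆S A-indep)
    (All.all-filter (λ A → (A ⊆? S) ×-dec indep? A) (subsets n))))

  rank-≥ : ∀ {A S} → A ⊆ S → Indep A → ∣ A ∣ ≤ rank S
  rank-≥ {A} {S} A⊆S A-indep = ≤-max (∈-map⁺ ∣_∣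
    (∈-filter⁺ (λ A → (A ⊆? S) ×-dec indep? A) (subsets-complete A) (A⊆S , A-indep)))

  rank-indep : ∀ {I} → Indep I → rank I ≡ ∣ I ∣
  rank-indep {I} I-indep = ℕ.≤-antisym
    (rank-≤ I λ A A⊆I _ → p⊆q⇒∣p∣≤∣q∣ A⊆I) (rank-≥ id I-indep)

  ∈cl⁻ : ∀ {S x} → x ∈ cl S → rank (S ∪ ⁅ x ⁆) ≡ rank S
  ∈cl⁻ {S} {x} x∈cl with rank (S ∪ ⁅ x ⁆) ℕ.≟ rank S in eq
  ... | yes r≡ = r≡
  ... | no  _  with () ← ≡.trans (≡.sym (Vec.[]=⇒lookup x∈cl))
                           (≡.trans (Vec.lookup∘tabulate _ x) (≡.cong does eq))

  ∈cl⁺ : ∀ {S x} → rank (S ∪ ⁅ x ⁆) ≡ rank S → x ∈ cl S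
  ∈cl⁺ {S} {x} r≡ = Vec.lookup⇒[]= x (cl S)
    (≡.trans (Vec.lookup∘tabulate _ x) (dec-true (rank (S ∪ ⁅ x ⁆) ℕ.≟ rank S) r≡))

  S⊆clS : ∀ {S} → S ⊆ cl S
  S⊆clS {S} {x} x∈S = ∈cl⁺ (≡.cong rank (⊆-antisym (∈∪-caseʳ {p = S} id (⁅x⁆⊆ x∈S)) (p⊆p∪q ⁅ x ⁆)))

  ∈cl⇒dependent : ∀ {I x} → Indep I → x ∈ cl I → x ∉ I → Dependent (I ∪ ⁅ x ⁆)
  ∈cl⇒dependent {I} {x} I-indep x∈cl x∉I I∪x-indep = ℕ.1+n≰n (begin
    suc ∣ I ∣          ≡⟨ ∣p∪⁅x⁆∣≡1+∣p∣ x∉I ⟨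
    ∣ I ∪ ⁅ x ⁆ ∣      ≤⟨ rank-≥ id I∪x-indep ⟩
    rank (I ∪ ⁅ x ⁆)   ≡⟨ ∈cl⁻ x∈cl ⟩
    rank I             ≡⟨ rank-indep I-indep ⟩
    ∣ I ∣              ∎)
    where open ℕ.≤-Reasoning

  ∉cl⇒indep : ∀ {I x} → Indep I → x ∉ cl I → Indep (I ∪ ⁅ x ⁆)
  ∉cl⇒indep {I} {x} I-indep x∉cl with indep? (I ∪ ⁅ x ⁆)
  ... | yes indep = indep
  ... | no  dep   = contradiction (∈cl⁺ (≡.trans rank≡ (≡.sym (rank-indep I-indep)))) x∉cl
    where
    -- An independent subset larger than `I` would have to be all of `I ∪ ⁅ x ⁆`, which is
    -- dependent.
    small : ∀ A → A ⊆ I ∪ ⁅ x ⁆ → Indep A → ∣ A ∣ ≤ ∣ I ∣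
    small A A⊆ A-indep with ∣ A ∣ ℕ.≤? ∣ I ∣
    ... | yes ∣A∣≤∣I∣ = ∣A∣≤∣I∣
    ... | no  ∣A∣≰∣I∣ = contradiction (hereditary (p⊆q∧∣q∣≤∣p∣⇒q⊆p A⊆ (begin
      ∣ I ∪ ⁅ x ⁆ ∣ ≡⟨ ∣p∪⁅x⁆∣≡1+∣p∣ (x∉cl ∘ S⊆clS) ⟩
      suc ∣ I ∣     ≤⟨ ℕ.≰⇒> ∣A∣≰∣I∣ ⟩
      ∣ A ∣         ∎)) A-indep) dep
      where open ℕ.≤-Reasoning

    rank≡ : rank (I ∪ ⁅ x ⁆) ≡ ∣ I ∣
    rank≡ = ℕ.≤-antisym (rank-≤ (I ∪ ⁅ x ⁆) small) (rank-≥ (p⊆p∪q ⁅ x ⁆) I-indep)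

  -- For an independent set, being outside the closure means that adjoining the element keeps
  -- independence, and this passes from `J ∪ ⁅ x ⁆` down to `I ∪ ⁅ x ⁆`.
  cl-mono : ∀ {I J} → Indep J → I ⊆ J → cl I ⊆ cl J
  cl-mono {I} {J} J-indep I⊆J {x} x∈clI with x ∈? cl J | x ∈? I
  ... | yes x∈clJ | _       = x∈clJ
  ... | no  x∉clJ | yes x∈I = S⊆clS (I⊆J x∈I)
  ... | no  x∉clJ | no  x∉I = contradiction
    (hereditary (∈∪-caseʳ {p = I} (p⊆p∪q ⁅ x ⁆ ∘ I⊆J) (q⊆p∪q J ⁅ x ⁆)) (∉cl⇒indep J-indep x∉clJ))
    (∈cl⇒dependent (hereditary I⊆J J-indep) x∈clI x∉I)

  ⊆cl⇒∣∣≤ : ∀ {I J} → Indep I → Indep J → J ⊆ cl I → ∣ J ∣ ≤ ∣ I ∣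
  ⊆cl⇒∣∣≤ I-indep J-indep J⊆clI = ℕ.≮⇒≥ λ ∣I∣<∣J∣ →
    let x , x∈J , x∉I , I∪x-indep = augmentation I-indep J-indep ∣I∣<∣J∣
    in ∈cl⇒dependent I-indep (J⊆clI x∈J) x∉I I∪x-indep

  -- Repeated augmentation of `A` from `B`; `k` bounds the number of elements still missing.
  extend : ∀ k {A B} → Indep A → Indep B → ∣ B ∣ ≤ k ℕ.+ ∣ A ∣ →
           ∃[ A′ ] Indep A′ × A ⊆ A′ × A′ ⊆ A ∪ B × ∣ B ∣ ≤ ∣ A′ ∣
  extend zero    {A} {B} A-indep B-indep ∣B∣≤ = A , A-indep , id , p⊆p∪q B , ∣B∣≤
  extend (suc k) {A} {B} A-indep B-indep ∣B∣≤ with ∣ A ∣ ℕ.<? ∣ B ∣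
  ... | no  ∣A∣≮∣B∣ = A , A-indep , id , p⊆p∪q B , ℕ.≮⇒≥ ∣A∣≮∣B∣
  ... | yes ∣A∣<∣B∣ =
    let x , x∈B , x∉A , A∪x-indep = augmentation A-indep B-indep ∣A∣<∣B∣
        A′ , A′-indep , A∪x⊆A′ , A′⊆ , ∣B∣≤∣A′∣ = extend k A∪x-indep B-indep
          (≡.subst (∣ B ∣ ≤_) (≡.trans (≡.sym (ℕ.+-suc k _)) (≡.cong (k ℕ.+_) (≡.sym (∣p∪⁅x⁆∣≡1+∣p∣ x∉A)))) ∣B∣≤)
    in A′ , A′-indep , A∪x⊆A′ ∘ p⊆p∪q ⁅ x ⁆ ,
       ∈∪-caseʳ {p = A ∪ ⁅ x ⁆} (∈∪-caseʳ {p = A} (p⊆p∪q B) (⁅x⁆⊆ (q⊆p∪q A B x∈B))) (q⊆p∪q A B) ∘ A′⊆ ,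
       ∣B∣≤∣A′∣

  indep-∪⁅⁆ : ∀ {I J x} → Indep I → Indep J → J ⊆ cl I → x ∉ cl I → Indep (J ∪ ⁅ x ⁆)
  indep-∪⁅⁆ {I} {J} {x} I-indep J-indep J⊆clI x∉clI
    with extend ∣ I ∪ ⁅ x ⁆ ∣ J-indep (∉cl⇒indep I-indep x∉clI) (ℕ.m≤m+n _ _)
  ... | J′ , J′-indep , J⊆J′ , J′⊆ , ∣I∪x∣≤∣J′∣ with x ∈? J′
  ...   | yes x∈J′ = hereditary (∈∪-caseʳ {p = J} J⊆J′ (⁅x⁆⊆ x∈J′)) J′-indep
  ...   | no  x∉J′ = contradiction (⊆cl⇒∣∣≤ I-indep J′-indep J′⊆clI)
            (ℕ.<⇒≱ (ℕ.≤-trans (ℕ.≤-reflexive (≡.sym (∣p∪⁅x⁆∣≡1+∣p∣ (x∉clI ∘ S⊆clS)))) ∣I∪x∣≤∣J′∣))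
    where
    J′⊆clI : J′ ⊆ cl I
    J′⊆clI {y} y∈J′ with x∈p∪q⁻ J (I ∪ ⁅ x ⁆) (J′⊆ y∈J′)
    ... | inj₁ y∈J   = J⊆clI y∈J
    ... | inj₂ y∈I∪x with x∈p∪q⁻ I ⁅ x ⁆ y∈I∪x
    ...   | inj₁ y∈I = S⊆clS y∈I
    ...   | inj₂ y∈x = contradiction (≡.subst (_∈ J′) (x∈⁅y⁆⇒x≡y x y∈x) y∈J′) x∉J′

  -- Circuits, broken circuits and nbc-sets

  dependent⇒circuit : ∀ {S} → Dependent S → ∃[ C ] C ⊆ S × Circuit C
  dependent⇒circuit {S} = go S (<-wellFounded _)
    where
    go : ∀ S → Acc ℕ._<_ ∣ S ∣ → Dependent S → ∃[ C ] C ⊆ S × Circuit C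
    go S (acc rec) S-dep with anySubset? (λ A → (A ⊂? S) ×-dec ¬? (indep? A))
    ... | yes (A , A⊂S , A-dep) =
      let C , C⊆A , C-circuit = go A (rec (p⊂q⇒∣p∣<∣q∣ A⊂S)) A-dep in C , proj₁ A⊂S ∘ C⊆A , C-circuit
    ... | no  ∄A = S , id , S-dep , λ A A⊂S → indep A A⊂S
      where
      indep : ∀ A → A ⊂ S → Indep A
      indep A A⊂S with indep? A
      ... | yes A-indep = A-indep
      ... | no  A-dep   = contradiction (A , A⊂S , A-dep) ∄A

  nonempty⇒min : ∀ {m} (S : Subset m) → Nonempty S → ∃[ i ] i ∈ S × (∀ j → j ∈ S → i Fin.≤ j)
  nonempty⇒min (inside  ∷ S) _                 = zero , here , λ _ _ → z≤n
  nonempty⇒min (outside ∷ S) (suc x , there x∈S) =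
    let i , i∈S , i≤ = nonempty⇒min S (x , x∈S)
    in suc i , there i∈S , λ { (suc j) (there j∈S) → s≤s (i≤ j j∈S) }

  nbc⇒indep : ∀ {S} → NBC S → Indep S
  nbc⇒indep {S} S-nbc with indep? S
  ... | yes S-indep = S-indep
  ... | no  S-dep with dependent⇒circuit S-dep
  ...   | C , C⊆S , C-circuit with nonempty? C
  ...     | yes C≢∅ = let i , i-min = nonempty⇒min C C≢∅ in
              ⊥-elim (S-nbc (C - i) (C , i , C-circuit , i-min , ≡.refl) (C⊆S ∘ p─q⊆p C ⁅ i ⁆))
  ...     | no  C≡∅ = contradiction
              (≡.subst Indep (≡.sym (Empty-unique C≡∅)) ∅-indep) (proj₁ C-circuit)

  nbc-⊆ : ∀ {S T} → S ⊆ T → NBC T → NBC S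
  nbc-⊆ S⊆T T-nbc B B-bc B⊆S = T-nbc B B-bc (S⊆T ∘ B⊆S)

  -- A circuit in `S ∪ ⁅ x ⁆` must contain `x`, since `S` is independent. Then `x` is its least
  -- element, and removing it leaves a broken circuit inside `S`.
  nbc∧least⇒indep : ∀ {S x} → NBC S → (∀ y → y ∈ S → x Fin.≤ y) → Indep (S ∪ ⁅ x ⁆)
  nbc∧least⇒indep {S} {x} S-nbc x≤S with indep? (S ∪ ⁅ x ⁆)
  ... | yes indep = indep
  ... | no  dep with dependent⇒circuit dep
  ...   | C , C⊆ , C-circuit with x ∈? C
  ...     | no  x∉C = contradiction
              (hereditary (p⊆q∪⁅x⁆∧x∉p⇒p⊆q {q = S} C⊆ x∉C) (nbc⇒indep S-nbc)) (proj₁ C-circuit)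
  ...     | yes x∈C = ⊥-elim
              (S-nbc (C - x) (C , x , C-circuit , (x∈C , x-min) , ≡.refl) (p⊆q∪⁅x⁆⇒p-x⊆q {p = C} {q = S} C⊆))
    where
    x-min : ∀ j → j ∈ C → x Fin.≤ j
    x-min j j∈C with x∈p∪q⁻ S ⁅ x ⁆ (C⊆ j∈C)
    ... | inj₁ j∈S = x≤S j j∈S
    ... | inj₂ j∈x = Fin.≤-reflexive (≡.sym (x∈⁅y⁆⇒x≡y x j∈x))

  -- The flats and layers of an nbc-set

  -- With xs the q largest elements of T, in increasing order, flat xs is the X_q of T.
  flat : List (Fin n) → Subset n
  flat xs = cl (fromList xs)

  layer : Fin n → List (Fin n) → Subset n
  layer x xs = flat (x ∷ xs) ─ flat xs

  fromList-⊆-∷ : ∀ x (xs : List (Fin n)) → fromList xs ⊆ fromList (x ∷ xs)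
  fromList-⊆-∷ x xs = q⊆p∪q ⁅ x ⁆ (fromList xs)

  nbc-tail : ∀ x xs → NBC (fromList (x ∷ xs)) → NBC (fromList xs)
  nbc-tail x xs = nbc-⊆ (fromList-⊆-∷ x xs)

  flat-⊆-∷ : ∀ x xs → NBC (fromList (x ∷ xs)) → flat xs ⊆ flat (x ∷ xs)
  flat-⊆-∷ x xs nbc = cl-mono (nbc⇒indep nbc) (fromList-⊆-∷ x xs)

  ∈layer : ∀ {x xs} → Sorted (x ∷ xs) → NBC (fromList (x ∷ xs)) → x ∈ layer x xs
  ∈layer {x} {xs} sorted nbc = x∈p∧x∉q⇒x∈p─q (S⊆clS (∈-fromList⁺ {xs = x ∷ xs} (here ≡.refl)))
    λ x∈flat → ∈cl⇒dependent (nbc⇒indep (nbc-tail x xs nbc)) x∈flat (sorted⇒∉ sorted)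
      (≡.subst Indep (fromList-∷ x xs) (nbc⇒indep nbc))

  -- An element `y` of the flat below `x` would lie below the whole list, so `nbc∧least⇒indep` would
  -- make it independent of a set whose closure contains it.
  head-least : ∀ {x xs} → Sorted (x ∷ xs) → NBC (fromList (x ∷ xs)) → ∀ y → y ∈ flat (x ∷ xs) → x Fin.≤ y
  head-least {x} {xs} (x< ∷ _) nbc y y∈flat with x Fin.≤? y
  ... | yes x≤y = x≤y
  ... | no  x≰y = contradiction
      (nbc∧least⇒indep nbc (λ z z∈ → ℕ.<⇒≤ (y< z (∈-fromList⁻ (x ∷ xs) z∈))))
      (∈cl⇒dependent (nbc⇒indep nbc) y∈flat
        (λ y∈ → Fin.<-irrefl ≡.refl (y< y (∈-fromList⁻ (x ∷ xs) y∈))))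
    where
    y< : ∀ z → z ∈ˡ x ∷ xs → y Fin.< z
    y< z (here ≡.refl)  = ℕ.≰⇒> x≰y
    y< z (there z∈xs)   = Fin.<-trans {i = y} {x} {z} (ℕ.≰⇒> x≰y) (All.lookup x< z∈xs)

  -- The complement of the last flat is kept apart because its factor in `z` is a monomial and not a
  -- boundary: one element of `S` in it already kills `e S`, while killing `∂ (e S)` takes two.
  data Crowded (S : Subset n) : List (Fin n) → Set where
    here  : ∀ {x xs} → Crowds S (layer x xs) → Crowded S (x ∷ xs)
    there : ∀ {x xs} → Crowded S xs → Crowded S (x ∷ xs)

  crowded? : ∀ S xs → Dec (Crowded S xs)
  crowded? S []       = no λ ()
  crowded? S (x ∷ xs) with crowds? S (layer x xs) | crowded? S xs
  ... | yes c | _     = yes (here c)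
  ... | no  _ | yes c = yes (there c)
  ... | no ¬c | no ¬d = no λ { (here c) → ¬c c ; (there d) → ¬d d }

  -- `X 0` is empty by definition, whereas `flat []` is the closure of the empty set; the absence of
  -- loops identifies the two.
  flat[]≡⊥ : Simple → flat [] ≡ ⊥
  flat[]≡⊥ simple = Empty-unique λ (x , x∈cl) → ∈cl⇒dependent ∅-indep x∈cl ∉⊥
    (≡.subst Indep (≡.sym (∪-identityˡ ⁅ x ⁆)) (simple⇒indep simple x))

  ∣flat∣ : ∀ {xs} → Sorted xs → NBC (fromList xs) → ∀ {S} → Indep S → S ⊆ flat xs → ∣ S ∣ ≤ length xs
  ∣flat∣ sorted nbc S-indep S⊆ = ℕ.≤-trans
    (⊆cl⇒∣∣≤ (nbc⇒indep nbc) S-indep S⊆) (ℕ.≤-reflexive (∣fromList∣≡length sorted))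

  module _ (simple : Simple) where

    -- Climbing from one flat to the next adds at most one element of `S`, and that element lies
    -- outside the smaller flat, so `indep-∪⁅⁆` applies.
    uncrowded⇒indep-∩ : ∀ {S} xs → NBC (fromList xs) → ¬ Crowded S xs → Indep (S ∩ flat xs)
    uncrowded⇒indep-∩ {S} [] nbc ¬c =
      hereditary (λ {x} x∈ → ≡.subst (x ∈_) (flat[]≡⊥ simple) (p∩q⊆q S (flat []) x∈)) ∅-indep
    uncrowded⇒indep-∩ {S} (x ∷ xs) nbc ¬c
      with uncrowded⇒indep-∩ {S} xs (nbc-tail x xs nbc) (¬c ∘ there)
         | uncrowded {S = S} {flat xs} {flat (x ∷ xs)} x∈p∧x∉q⇒x∈p─q (¬c ∘ here)
    ... | indep | inj₁ ⊆S∩X                 = hereditary ⊆S∩X indep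
    ... | indep | inj₂ (y , _ , y∉X , ⊆S∩X∪y) = hereditary ⊆S∩X∪y
      (indep-∪⁅⁆ (nbc⇒indep (nbc-tail x xs nbc)) indep (p∩q⊆q S (flat xs)) y∉X)

    uncrowded⇒indep : ∀ {S} xs → NBC (fromList xs) →
                      ¬ Crowded S xs → ¬ Crowds S (∁ (flat xs)) → Indep S
    uncrowded⇒indep {S} xs nbc ¬c ¬r
      with uncrowded⇒indep-∩ {S} xs nbc ¬c
         | uncrowded {S = S} {flat xs} {⊤} (λ _ → x∉p⇒x∈∁p) ¬r
    ... | indep | inj₁ ⊆S∩X                 = hereditary (λ {x} x∈S → ⊆S∩X (x∈p∩q⁺ (x∈S , ∈⊤))) indep
    ... | indep | inj₂ (y , _ , y∉X , ⊆S∩X∪y) = hereditary (λ {x} x∈S → ⊆S∩X∪y (x∈p∩q⁺ (x∈S , ∈⊤)))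
      (indep-∪⁅⁆ (nbc⇒indep nbc) indep (p∩q⊆q S (flat xs)) y∉X)

    -- A rank count: if `x` were missing from `S`, then `x`, being least in its flat, could be
    -- adjoined to the nbc-set `S ∩ flat (x ∷ xs)`, giving an independent set larger than the rank
    -- of the flat. Passing to the smaller flat loses at most one element of `S`, so the lower bound
    -- on the size survives the induction.
    uncrowded-nbc⇒⊆ : ∀ {S} → NBC S → ∀ xs → Sorted xs → NBC (fromList xs) → ¬ Crowded S xs →
                      length xs ≤ ∣ S ∩ flat xs ∣ → All (_∈ S) xs
    uncrowded-nbc⇒⊆     S-nbc []       sorted nbc ¬c len≤ = []
    uncrowded-nbc⇒⊆ {S} S-nbc (x ∷ xs) sorted@(_ ∷ sorted-xs) nbc ¬c len≤ =
      x∈S ∷ uncrowded-nbc⇒⊆ S-nbc xs sorted-xs (nbc-tail x xs nbc) (¬c ∘ there)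
        (ℕ.≤-pred (ℕ.≤-trans len≤ (∣S∩Y∣≤1+∣S∩X∣ (¬c ∘ here))))
      where
      J : Subset n
      J = S ∩ flat (x ∷ xs)

      J-nbc : NBC J
      J-nbc = nbc-⊆ (p∩q⊆p S (flat (x ∷ xs))) S-nbc

      x∈flat : x ∈ flat (x ∷ xs)
      x∈flat = p─q⊆p (flat (x ∷ xs)) (flat xs) (∈layer sorted nbc)

      x∈S : x ∈ S
      x∈S with x ∈? S
      ... | yes x∈S = x∈S
      ... | no  x∉S = contradiction
        (∣flat∣ sorted nbc
          (nbc∧least⇒indep J-nbc (λ y y∈J → head-least sorted nbc y (p∩q⊆q S (flat (x ∷ xs)) y∈J)))
          (∈∪-caseʳ {p = J} (p∩q⊆q S (flat (x ∷ xs))) (⁅x⁆⊆ x∈flat)))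
        (ℕ.<⇒≱ (ℕ.≤-trans (s≤s len≤) (ℕ.≤-reflexive (≡.sym (∣p∪⁅x⁆∣≡1+∣p∣ (x∉S ∘ p∩q⊆p S (flat (x ∷ xs))))))))

    nbc-transversal⇒≡ : ∀ {S T} → NBC S → NBC T → ∣ S ∣ ≡ ∣ T ∣ →
                        ¬ Crowded S (elements T) → S ⊆ flat (elements T) → T ≡ S
    nbc-transversal⇒≡ {S} {T} S-nbc T-nbc ∣S∣≡∣T∣ ¬c S⊆flat = ⊆-antisym T⊆S
      (p⊆q∧∣q∣≤∣p∣⇒q⊆p T⊆S (ℕ.≤-reflexive ∣S∣≡∣T∣))
      where
      T≡ : fromList (elements T) ≡ T
      T≡ = fromList-elements T

      all∈S : All (_∈ S) (elements T)
      all∈S = uncrowded-nbc⇒⊆ S-nbc (elements T) (elements-sorted T) (≡.subst NBC (≡.sym T≡) T-nbc) ¬c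
        (ℕ.≤-trans (ℕ.≤-reflexive (≡.trans (length-elements T) (≡.sym ∣S∣≡∣T∣)))
                   (p⊆q⇒∣p∣≤∣q∣ (λ x∈S → x∈p∩q⁺ (x∈S , S⊆flat x∈S))))

      T⊆S : T ⊆ S
      T⊆S x∈T = All.lookup all∈S (∈-fromList⁻ (elements T) (≡.subst (_ ∈_) (≡.sym T≡) x∈T))

-- Exterior algebra up to sign

module ExteriorProperties {c ℓ} (R : CommutativeRing c ℓ) where
  open CommutativeRing R hiding (_-_; zero)
  open Exterior R
  open RingProperties ring using (-0#≈0#; -1*x≈-x; -‿involutive)
  open Exp semiring using (^-homo-*)
  private
    module *ₚ = CommutativeSemigroupProperties (CommutativeRing.*-commutativeSemigroup R)
  open SetoidReasoning setoid

  sgn² : ∀ k → sgn k * sgn k ≈ 1#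
  sgn² zero    = *-identityˡ 1#
  sgn² (suc k) = begin
    (- 1# * sgn k) * (- 1# * sgn k) ≈⟨ *ₚ.interchange _ _ _ _ ⟩
    (- 1# * - 1#) * (sgn k * sgn k) ≈⟨ *-cong (trans (-1*x≈-x _) (-‿involutive 1#)) (sgn² k) ⟩
    1# * 1#                         ≈⟨ *-identityˡ 1# ⟩
    1#                              ∎

  sgn-cancel : ∀ k {x} → sgn k * x ≈ 0# → x ≈ 0#
  sgn-cancel k {x} eq = begin
    x                     ≈⟨ *-identityˡ x ⟨
    1# * x                ≈⟨ *-congʳ (sgn² k) ⟨
    (sgn k * sgn k) * x   ≈⟨ *-assoc _ _ _ ⟩
    sgn k * (sgn k * x)   ≈⟨ *-congˡ eq ⟩
    sgn k * 0#            ≈⟨ zeroʳ _ ⟩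
    0#                    ∎

  infix 4 _~_

  -- The exponent is kept as data: the signs on the diagonal of the pairing return as factors of the
  -- coordinates in the spanning argument.
  record _~_ {n} (a b : E n) : Set ℓ where
    constructor _,_
    field
      exponent : ℕ
      equality : a ≈ᴱ sgn exponent · b

  ≈⇒~ : {a b : E n} → a ≈ᴱ b → a ~ b
  ≈⇒~ a≈b = 0 , λ S → trans (a≈b S) (sym (*-identityˡ _))

  ~-refl : {a : E n} → a ~ a
  ~-refl = ≈⇒~ λ S → refl

  ~-sym : {a b : E n} → a ~ b → b ~ a
  ~-sym {a = a} {b} (k , a≈b) = k , λ S → begin
    b S                     ≈⟨ *-identityˡ _ ⟨
    1# * b S                ≈⟨ *-congʳ (sgn² k) ⟨
    (sgn k * sgn k) * b S   ≈⟨ *-assoc _ _ _ ⟩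
    sgn k * (sgn k * b S)   ≈⟨ *-congˡ (a≈b S) ⟨
    sgn k * a S             ∎

  ~-trans : {a b d : E n} → a ~ b → b ~ d → a ~ d
  ~-trans {a = a} {b} {d} (k , a≈b) (l , b≈d) = k ℕ.+ l , λ S → begin
    a S                     ≈⟨ a≈b S ⟩
    sgn k * b S             ≈⟨ *-congˡ (b≈d S) ⟩
    sgn k * (sgn l * d S)   ≈⟨ *-assoc _ _ _ ⟨
    (sgn k * sgn l) * d S   ≈⟨ *-congʳ (^-homo-* (- 1#) k l) ⟨
    sgn (k ℕ.+ l) * d S     ∎

  ~-setoid : ℕ → Setoid c ℓ
  ~-setoid n = record
    { Carrier = E n
    ; _≈_ = _~_
    ; isEquivalence = record { refl = ~-refl ; sym = ~-sym ; trans = ~-trans }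
    }

  ∧-~-congˡ : {a b b′ : E n} → b ~ b′ → a ∧ b ~ a ∧ b′
  ∧-~-congˡ {a = a} {b′ = b′} (k , b≈) = k , λ S → trans (∧-congˡ b≈ S) (∧-· (sgn k) a b′ S)

  ∧-~-congʳ : {a a′ b : E n} → a ~ a′ → a ∧ b ~ a′ ∧ b
  ∧-~-congʳ {a′ = a′} {b} (k , a≈) = k , λ S → trans (∧-congʳ a≈ S) (·-∧ (sgn k) a′ b S)

  ~0 : {a b : E n} → a ~ b → b ≈ᴱ 0ᴱ → a ≈ᴱ 0ᴱ
  ~0 (k , a≈b) b≈0 S = trans (a≈b S) (trans (*-congˡ (b≈0 S)) (zeroʳ _))

  ~0-at : ∀ {a b : E n} S → a ~ b → b S ≈ 0# → a S ≈ 0#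
  ~0-at S (k , a≈b) b≈0 = trans (a≈b S) (trans (*-congˡ b≈0) (zeroʳ _))

  homogeneous⇒inv~ : ∀ p {a : E n} → Homogeneous p a → inv a ~ a
  homogeneous⇒inv~ p hom = p , homogeneous⇒inv p hom

  hom-₁-0 : {a : E (suc n)} → Homogeneous 0 a → a ₁ ≈ᴱ 0ᴱ
  hom-₁-0 hom S = hom (inside ∷ S) λ ()

  hom-₁ : ∀ {p} {a : E (suc n)} → Homogeneous (suc p) a → Homogeneous p (a ₁)
  hom-₁ hom S ∣S∣≢p = hom (inside ∷ S) (∣S∣≢p ∘ ℕ.suc-injective)

  hom-cong : ∀ {p} {a b : E n} → a ≈ᴱ b → Homogeneous p a → Homogeneous p b
  hom-cong a≈b hom S ∣S∣≢p = trans (sym (a≈b S)) (hom S ∣S∣≢p)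

  hom-· : ∀ {p} r {a : E n} → Homogeneous p a → Homogeneous p (r · a)
  hom-· r hom S ∣S∣≢p = trans (*-congˡ (hom S ∣S∣≢p)) (zeroʳ r)

  hom-+ : ∀ {p} {a b : E n} → Homogeneous p a → Homogeneous p b → Homogeneous p (a +ᴱ b)
  hom-+ ha hb S ∣S∣≢p = trans (+-cong (ha S ∣S∣≢p) (hb S ∣S∣≢p)) (+-identityˡ 0#)

  hom-inv : ∀ {p} {a : E n} → Homogeneous p a → Homogeneous p (inv a)
  hom-inv hom S ∣S∣≢p = trans (*-congˡ (hom S ∣S∣≢p)) (zeroʳ _)

  hom-∧ : ∀ p q {a b : E n} → Homogeneous p a → Homogeneous q b → Homogeneous (p ℕ.+ q) (a ∧ b)
  hom-∧ {zero} zero    zero    ha hb []            neq = contradiction ≡.refl neq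
  hom-∧ {zero} zero    (suc q) ha hb []            neq = trans (*-congˡ (hb [] λ ())) (zeroʳ _)
  hom-∧ {zero} (suc p) q       ha hb []            neq = trans (*-congʳ (ha [] λ ())) (zeroˡ _)
  hom-∧ {suc n} p q ha hb (outside ∷ S) neq = hom-∧ p q (ha ∘ (outside ∷_)) (hb ∘ (outside ∷_)) S neq
  hom-∧ {suc n} p q {a} {b} ha hb (inside ∷ S) neq =
    trans (+-cong (left p ha neq) (right q hb neq)) (+-identityˡ 0#)
    where
    left : ∀ p → Homogeneous p a → suc ∣ S ∣ ≢ p ℕ.+ q → (a ₁ ∧ b ₀) S ≈ 0#
    left zero     ha neq = trans (∧-congʳ (hom-₁-0 ha) S) (∧-zeroˡ (b ₀) S)
    left (suc p) ha neq = hom-∧ p q (hom-₁ ha) (hb ∘ (outside ∷_)) S (neq ∘ ≡.cong suc)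
    right : ∀ q → Homogeneous q b → suc ∣ S ∣ ≢ p ℕ.+ q → (inv (a ₀) ∧ b ₁) S ≈ 0#
    right zero    hb neq = trans (∧-congˡ (hom-₁-0 hb) S) (∧-zeroʳ (inv (a ₀)) S)
    right (suc q) hb neq = hom-∧ p q (hom-inv {a = a ₀} (ha ∘ (outside ∷_))) (hom-₁ hb) S
      (λ eq → neq (≡.trans (≡.cong suc eq) (≡.sym (ℕ.+-suc p q))))

  e-homogeneous : (S : Subset n) → Homogeneous ∣ S ∣ (e S)
  e-homogeneous S = hom-cong (λ T → sym (e≈basis S T)) (basis-homogeneous S)

  ∂-homogeneous : ∀ p {a : E n} → Homogeneous p a → Homogeneous (p ∸ 1) (∂ a)
  ∂-homogeneous zero    hom S _ = ∂-degree₀ hom S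
  ∂-homogeneous (suc p) hom     = ∂-degree p hom

  -- Moving a factor of degree `d` past `b` multiplies the degree `q` part of `b` by (-1)^(dq). This
  -- is the `d`-fold grade involution, which makes sense for inhomogeneous `b`.
  invs : ℕ → E n → E n
  invs zero    a = a
  invs (suc d) a = inv (invs d a)

  invs-₀ : ∀ d (a : E (suc n)) → invs d a ₀ ≈ᴱ invs d (a ₀)
  invs-₀ zero    a S = refl
  invs-₀ (suc d) a S = *-congˡ (invs-₀ d a S)

  invs-₁ : ∀ d (a : E (suc n)) → invs d a ₁ ≈ᴱ sgn d · invs d (a ₁)
  invs-₁ zero    a S = sym (*-identityˡ _)
  invs-₁ (suc d) a S = begin
    (- 1# * sgn ∣ S ∣) * invs d a (inside ∷ S)      ≈⟨ *-congˡ (invs-₁ d a S) ⟩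
    (- 1# * sgn ∣ S ∣) * (sgn d * invs d (a ₁) S)   ≈⟨ *ₚ.interchange _ _ _ _ ⟩
    (- 1# * sgn d) * (sgn ∣ S ∣ * invs d (a ₁) S)   ∎

  invs-~ : ∀ d {p} {a : E n} → Homogeneous p a → invs d a ~ a
  invs-~ zero    hom = ~-refl
  invs-~ (suc d) {p} hom = ~-trans (homogeneous⇒inv~ p (hom-invs d)) (invs-~ d hom)
    where
    hom-invs : ∀ d → Homogeneous p (invs d _)
    hom-invs zero    = hom
    hom-invs (suc d) = hom-inv (hom-invs d)

  invs-[] : ∀ d (a : E 0) → invs d a [] ≈ a []
  invs-[] zero    a = refl
  invs-[] (suc d) a = trans (*-identityˡ _) (invs-[] d a)

  ∧-comm-invs : ∀ d {a : E n} → Homogeneous d a → ∀ b → a ∧ b ≈ᴱ invs d b ∧ a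
  ∧-comm-invs {zero}  d ha b [] = trans (*-comm _ _) (*-congʳ (sym (invs-[] d b)))
  ∧-comm-invs {suc n} d {a} ha b (outside ∷ S) = trans
    (∧-comm-invs d (ha ∘ (outside ∷_)) (b ₀) S) (∧-congʳ (λ T → sym (invs-₀ d b T)) S)
  ∧-comm-invs {suc n} d {a} ha b (inside ∷ S) = trans (+-cong (left d ha) right) (+-comm _ _)
    where
    left : ∀ d → Homogeneous d a → (a ₁ ∧ b ₀) S ≈ (inv (invs d b ₀) ∧ a ₁) S
    left zero    ha = trans
      (trans (∧-congʳ (hom-₁-0 ha) S) (∧-zeroˡ (b ₀) S))
      (sym (trans (∧-congˡ (hom-₁-0 ha) S) (∧-zeroʳ (inv (b ₀)) S)))
    left (suc d) ha = begin
      (a ₁ ∧ b ₀) S                          ≈⟨ ∧-comm-invs d (hom-₁ ha) (b ₀) S ⟩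
      (invs d (b ₀) ∧ a ₁) S                 ≈⟨ ∧-congʳ (invs-₀ d b) S ⟨
      ((invs d b ₀) ∧ a ₁) S                 ≈⟨ ∧-congʳ (inv-inv (invs d b ₀)) S ⟨
      (inv (inv (invs d b ₀)) ∧ a ₁) S       ∎
    right : (inv (a ₀) ∧ b ₁) S ≈ (invs d b ₁ ∧ a ₀) S
    right = begin
      (inv (a ₀) ∧ b ₁) S             ≈⟨ ∧-congʳ (homogeneous⇒inv d (ha ∘ (outside ∷_))) S ⟩
      ((sgn d · a ₀) ∧ b ₁) S         ≈⟨ ·-∧ (sgn d) (a ₀) (b ₁) S ⟩
      sgn d * (a ₀ ∧ b ₁) S           ≈⟨ *-congˡ (∧-comm-invs d (ha ∘ (outside ∷_)) (b ₁) S) ⟩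
      sgn d * (invs d (b ₁) ∧ a ₀) S  ≈⟨ ·-∧ (sgn d) (invs d (b ₁)) (a ₀) S ⟨
      ((sgn d · invs d (b ₁)) ∧ a ₀) S ≈⟨ ∧-congʳ (invs-₁ d b) S ⟨
      (invs d b ₁ ∧ a ₀) S            ∎

  ∧-comm~ : ∀ {p q} {a b : E n} → Homogeneous p a → Homogeneous q b → a ∧ b ~ b ∧ a
  ∧-comm~ {p = p} {a = a} {b} ha hb = ~-trans (≈⇒~ (∧-comm-invs p ha b)) (∧-~-congʳ (invs-~ p hb))

  -- Graded commutativity moves `a` past `x`, next to `b`. It disposes of the arbitrary factors that
  -- an ideal puts in front of its generators.
  ∧-absorb : ∀ {d} {a b : E n} → Homogeneous d a → a ∧ b ≈ᴱ 0ᴱ → ∀ x → a ∧ (x ∧ b) ≈ᴱ 0ᴱ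
  ∧-absorb {d = d} {a} {b} ha ab≈0 x S = begin
    (a ∧ (x ∧ b)) S          ≈⟨ ∧-assoc a x b S ⟨
    ((a ∧ x) ∧ b) S          ≈⟨ ∧-congʳ (∧-comm-invs d ha x) S ⟩
    ((invs d x ∧ a) ∧ b) S   ≈⟨ ∧-assoc (invs d x) a b S ⟩
    (invs d x ∧ (a ∧ b)) S   ≈⟨ ∧-congˡ ab≈0 S ⟩
    (invs d x ∧ 0ᴱ) S        ≈⟨ ∧-zeroʳ (invs d x) S ⟩
    0#                       ∎

  0∧+∧0 : ∀ (a b : E n) S → (0ᴱ ∧ b) S + (a ∧ 0ᴱ) S ≈ 0#
  0∧+∧0 a b S = trans (+-cong (∧-zeroˡ b S) (∧-zeroʳ a S)) (+-identityˡ 0#)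

  inv0∧ : ∀ (b : E n) → inv 0ᴱ ∧ b ≈ᴱ 0ᴱ
  inv0∧ b S = trans (∧-congʳ inv-0 S) (∧-zeroˡ b S)

  -- Products of monomials

  gen-∧-basis : ∀ {i} {B : Subset n} → i ∈ B → gen i ∧ basis B ≈ᴱ 0ᴱ
  gen-∧-basis {i = zero}  {inside ∷ B} here        (outside ∷ S) = ∧-zeroˡ 0ᴱ S
  gen-∧-basis {i = zero}  {inside ∷ B} here        (inside  ∷ S) =
    trans (+-cong (∧-zeroʳ 1ᴱ S) (inv0∧ (basis B) S)) (+-identityˡ 0#)
  gen-∧-basis {i = suc i} {outside ∷ B} (there i∈B) (outside ∷ S) = gen-∧-basis i∈B S
  gen-∧-basis {i = suc i} {outside ∷ B} (there i∈B) (inside  ∷ S) = 0∧+∧0 (inv (gen i)) (basis B) S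
  gen-∧-basis {i = suc i} {inside ∷ B}  (there i∈B) (outside ∷ S) = ∧-zeroʳ (gen i) S
  gen-∧-basis {i = suc i} {inside ∷ B}  (there i∈B) (inside  ∷ S) = trans
    (+-cong (∧-zeroˡ 0ᴱ S) (trans (∧-congʳ (homogeneous⇒inv 1 (gen-homogeneous i)) S)
      (trans (·-∧ (sgn 1) (gen i) (basis B) S) (trans (*-congˡ (gen-∧-basis i∈B S)) (zeroʳ _)))))
    (+-identityˡ 0#)

  gen-∧-e : ∀ {i} {B : Subset n} → i ∈ B → gen i ∧ e B ≈ᴱ 0ᴱ
  gen-∧-e {B = B} i∈B S = trans (∧-congˡ (e≈basis B) S) (gen-∧-basis i∈B S)

  ∂-gen-∧ : ∀ i (a : E n) → ∂ (gen i ∧ a) ≈ᴱ a +ᴱ (-ᴱ (gen i ∧ ∂ a))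
  ∂-gen-∧ i a S = begin
    ∂ (gen i ∧ a) S                            ≈⟨ ∂-∧ (gen i) a S ⟩
    (∂ (gen i) ∧ a) S + (inv (gen i) ∧ ∂ a) S
      ≈⟨ +-cong (trans (∧-congʳ (∂-gen i) S) (∧-identityˡ a S))
          (trans (∧-congʳ (λ T → trans (homogeneous⇒inv 1 (gen-homogeneous i) T)
                                 (trans (*-congʳ (*-identityʳ (- 1#))) (-1*x≈-x _))) S)
                 (∧-negˡ (gen i) (∂ a) S)) ⟩
    a S + - (gen i ∧ ∂ a) S                    ∎

  -- Since eᵢ e_B = 0, applying ∂ gives e_B - eᵢ ∂e_B = 0.
  gen-∧-∂e : ∀ {i} {B : Subset n} → i ∈ B → gen i ∧ ∂ (e B) ≈ᴱ e B
  gen-∧-∂e {i = i} {B} i∈B S = sym (begin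
    e B S                                           ≈⟨ +-identityʳ _ ⟨
    e B S + 0#                                      ≈⟨ +-congˡ (-‿inverseˡ _) ⟨
    e B S + (- (gen i ∧ ∂ (e B)) S + (gen i ∧ ∂ (e B)) S) ≈⟨ +-assoc _ _ _ ⟨
    (e B S + - (gen i ∧ ∂ (e B)) S) + (gen i ∧ ∂ (e B)) S ≈⟨ +-congʳ (∂-gen-∧ i (e B) S) ⟨
    ∂ (gen i ∧ e B) S + (gen i ∧ ∂ (e B)) S         ≈⟨ +-congʳ (trans (∂-cong (gen-∧-e i∈B) S) (∂-0 S)) ⟩
    0# + (gen i ∧ ∂ (e B)) S                        ≈⟨ +-identityˡ _ ⟩
    (gen i ∧ ∂ (e B)) S                             ∎)

  -- A common generator can be split off as `e A = gen x ∧ ∂ (e A)`, and `gen x` kills `e B`.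
  e-∧-overlap : ∀ {x} {A B : Subset n} → x ∈ A → x ∈ B → e A ∧ e B ≈ᴱ 0ᴱ
  e-∧-overlap {x = x} {A} {B} x∈A x∈B S = begin
    (e A ∧ e B) S                    ≈⟨ ∧-congʳ (gen-∧-∂e x∈A) S ⟨
    ((gen x ∧ ∂ (e A)) ∧ e B) S      ≈⟨ ∧-assoc (gen x) (∂ (e A)) (e B) S ⟩
    (gen x ∧ (∂ (e A) ∧ e B)) S      ≈⟨ ∧-absorb (gen-homogeneous x) (gen-∧-e x∈B) (∂ (e A)) S ⟩
    0#                               ∎

  Disjoint : Subset n → Subset n → Set
  Disjoint A B = ∀ {x} → x ∈ A → x ∉ B

  basis-∧ : ∀ {A B : Subset n} → Disjoint A B → basis A ∧ basis B ~ basis (A ∪ B)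
  basis-∧ {A = []} {[]} _ = ≈⇒~ λ { [] → *-identityˡ _ }
  basis-∧ {A = outside ∷ A} {outside ∷ B} disj
    with k , eq ← basis-∧ {A = A} {B} (λ x∈A x∈B → disj (there x∈A) (there x∈B)) = k , λ
      { (outside ∷ S) → eq S
      ; (inside  ∷ S) → trans (0∧+∧0 (inv (basis A)) (basis B) S) (sym (zeroʳ _)) }
  basis-∧ {A = inside ∷ A} {outside ∷ B} disj
    with k , eq ← basis-∧ {A = A} {B} (λ x∈A x∈B → disj (there x∈A) (there x∈B)) = k , λ
      { (outside ∷ S) → trans (∧-zeroˡ (basis B) S) (sym (zeroʳ _))
      ; (inside  ∷ S) → trans (+-cong (eq S) (∧-zeroʳ (inv 0ᴱ) S)) (+-identityʳ _) }
  basis-∧ {A = outside ∷ A} {inside ∷ B} disj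
    with k , eq ← ~-trans (∧-~-congʳ {b = basis B} (homogeneous⇒inv~ _ (basis-homogeneous A)))
                     (basis-∧ {A = A} {B} (λ x∈A x∈B → disj (there x∈A) (there x∈B))) = k , λ
      { (outside ∷ S) → trans (∧-zeroʳ (basis A) S) (sym (zeroʳ _))
      ; (inside  ∷ S) → trans (+-cong (∧-zeroˡ 0ᴱ S) (eq S)) (+-identityˡ _) }
  basis-∧ {A = inside ∷ A} {inside ∷ B} disj = contradiction here (disj here)

  e-∧ : ∀ {A B : Subset n} → Disjoint A B → e A ∧ e B ~ e (A ∪ B)
  e-∧ {A = A} {B} disj = ~-trans (≈⇒~ (∧-cong (e≈basis A) (e≈basis B)))
    (~-trans (basis-∧ disj) (≈⇒~ (λ S → sym (e≈basis (A ∪ B) S))))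

  gen≈e : (i : Fin n) → gen i ≈ᴱ e ⁅ i ⁆
  gen≈e i S = sym (e≈basis ⁅ i ⁆ S)

  -- The top-degree pairing

  pairing-e-∁ : (U : Subset n) → ∃ λ k → ∀ a → (a ∧ basis (∁ U)) ⊤ ≈ sgn k * a U
  pairing-e-∁ []            = 0 , λ a → trans (*-identityʳ _) (sym (*-identityˡ _))
  pairing-e-∁ (inside  ∷ U) = let k , eq = pairing-e-∁ U in k , λ a →
    trans (+-cong (eq (a ₁)) (∧-zeroʳ (inv (a ₀)) ⊤)) (+-identityʳ _)
  -- The least generator now comes from the second factor and is moved past the part of `a` at `U`,
  -- of degree `∣ U ∣`; hence the extra exponent.
  pairing-e-∁ (outside ∷ U) = let k , eq = pairing-e-∁ U in k ℕ.+ ∣ U ∣ , λ a → begin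
    (a ₁ ∧ 0ᴱ) ⊤ + (inv (a ₀) ∧ basis (∁ U)) ⊤   ≈⟨ +-cong (∧-zeroʳ (a ₁) ⊤) (eq (inv (a ₀))) ⟩
    0# + sgn k * (sgn ∣ U ∣ * a (outside ∷ U))    ≈⟨ +-identityˡ _ ⟩
    sgn k * (sgn ∣ U ∣ * a (outside ∷ U))         ≈⟨ *-assoc _ _ _ ⟨
    (sgn k * sgn ∣ U ∣) * a (outside ∷ U)         ≈⟨ *-congʳ (^-homo-* (- 1#) k ∣ U ∣) ⟨
    sgn (k ℕ.+ ∣ U ∣) * a (outside ∷ U)           ∎

  pairing-nondegenerate : (a : E n) → (∀ S → (a ∧ e S) ⊤ ≈ 0#) → a ≈ᴱ 0ᴱ
  pairing-nondegenerate a a∧e≈0 U = let k , eq = pairing-e-∁ U in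
    sgn-cancel k (trans (sym (eq a)) (trans (∧-congˡ (λ S → sym (e≈basis (∁ U) S)) ⊤) (a∧e≈0 (∁ U))))

  -- Expands `x` into monomials. For `x` a boundary only its support has to be known, never its
  -- coefficients.
  sandwich-zero : ∀ (a x b : E n) S → (∀ A → x A ≈ 0# ⊎ (a ∧ (e A ∧ b)) S ≈ 0#) → (a ∧ (x ∧ b)) S ≈ 0#
  sandwich-zero {n} a x b S x-spanned = trans (∧-congˡ (∧-congʳ (expansion x)) S) (go (subsets n))
    where
    go : ∀ As → (a ∧ (foldr (λ A y → (x A · e A) +ᴱ y) 0ᴱ As ∧ b)) S ≈ 0#
    go []       = trans (∧-congˡ (∧-zeroˡ b) S) (∧-zeroʳ a S)
    go (A ∷ As) = begin
      (a ∧ (((x A · e A) +ᴱ y) ∧ b)) S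
        ≈⟨ ∧-congˡ (∧-distribʳ b (x A · e A) y) S ⟩
      (a ∧ (((x A · e A) ∧ b) +ᴱ (y ∧ b))) S
        ≈⟨ ∧-distribˡ a ((x A · e A) ∧ b) (y ∧ b) S ⟩
      (a ∧ ((x A · e A) ∧ b)) S + (a ∧ (y ∧ b)) S
        ≈⟨ +-cong (trans (∧-congˡ (·-∧ (x A) (e A) b) S) (∧-· (x A) a (e A ∧ b) S)) (go As) ⟩
      x A * (a ∧ (e A ∧ b)) S + 0#
        ≈⟨ +-identityʳ _ ⟩
      x A * (a ∧ (e A ∧ b)) S
        ≈⟨ [ (λ xA≈0 → trans (*-congʳ xA≈0) (zeroˡ _)) , (λ z≈0 → trans (*-congˡ z≈0) (zeroʳ _)) ]′ (x-spanned A) ⟩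
      0# ∎
      where
      y : E n
      y = foldr (λ A y → (x A · e A) +ᴱ y) 0ᴱ As

  -- Boundaries and the products killed by crowding

  ∂-basis-support : ∀ (B A : Subset n) → ∂ (basis B) A ≈ 0# ⊎ ∃[ j ] j ∈ B × A ≡ B - j
  ∂-basis-support []            []            = inj₁ refl
  ∂-basis-support (outside ∷ B) (inside  ∷ A) = inj₁ (trans (-‿cong (∂-0 A)) -0#≈0#)
  ∂-basis-support (outside ∷ B) (outside ∷ A) with ∂-basis-support B A
  ... | inj₁ eq               = inj₁ (trans (+-identityʳ _) eq)
  ... | inj₂ (j , j∈B , A≡) = inj₂ (suc j , there j∈B , ≡.cong (outside ∷_) A≡)
  ∂-basis-support (inside  ∷ B) (inside  ∷ A) with ∂-basis-support B A
  ... | inj₁ eq               = inj₁ (trans (-‿cong eq) -0#≈0#)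
  ... | inj₂ (j , j∈B , A≡) = inj₂ (suc j , there j∈B , ≡.cong (inside ∷_) A≡)
  ∂-basis-support (inside  ∷ B) (outside ∷ A) with B ≟ˢ A
  ... | yes ≡.refl = inj₂ (zero , here , ≡.cong (outside ∷_) (≡.sym (p─⊥≡p B)))
  ... | no  _      = inj₁ (trans (+-identityʳ _) (∂-0 A))

  ∂e-support : ∀ (B A : Subset n) → ∂ (e B) A ≈ 0# ⊎ ∃[ j ] j ∈ B × A ≡ B - j
  ∂e-support B A with ∂-basis-support B A
  ... | inj₁ eq = inj₁ (trans (∂-cong (e≈basis B) A) eq)
  ... | inj₂ jp = inj₂ jp

  crowds-e : ∀ {S B : Subset n} j → Crowds S B → e (B - j) ∧ e S ≈ᴱ 0ᴱ
  crowds-e j (x , y , x≢y , (x∈S , x∈B) , (y∈S , y∈B)) with x Fin.≟ j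
  ... | no  x≢j    = e-∧-overlap (x∈p∧x≢y⇒x∈p-y x∈B x≢j) x∈S
  ... | yes ≡.refl = e-∧-overlap (x∈p∧x≢y⇒x∈p-y y∈B (x≢y ∘ ≡.sym)) y∈S

  crowds-sym : ∀ {S B : Subset n} → Crowds S B → Crowds B S
  crowds-sym (x , y , x≢y , (x∈S , x∈B) , (y∈S , y∈B)) = x , y , x≢y , (x∈B , x∈S) , (y∈B , y∈S)

  crowds⇒∂e∧e : ∀ {S B : Subset n} → Crowds S B → ∂ (e B) ∧ e S ≈ᴱ 0ᴱ
  crowds⇒∂e∧e {S = S} {B} crowds T = trans (sym (∧-identityˡ _ T))
    (sandwich-zero 1ᴱ (∂ (e B)) (e S) T λ A → go A (∂e-support B A))
    where
    go : ∀ A → ∂ (e B) A ≈ 0# ⊎ ∃[ j ] j ∈ B × A ≡ B - j → ∂ (e B) A ≈ 0# ⊎ (1ᴱ ∧ (e A ∧ e S)) T ≈ 0#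
    go A (inj₁ eq)               = inj₁ eq
    go A (inj₂ (j , _ , ≡.refl)) = inj₂ (trans (∧-identityˡ _ T) (crowds-e j crowds T))

  ∂e-homogeneous : (S : Subset n) → Homogeneous (∣ S ∣ ∸ 1) (∂ (e S))
  ∂e-homogeneous S = ∂-homogeneous ∣ S ∣ (e-homogeneous S)

  crowds⇒e∧∂e : ∀ {S B : Subset n} → Crowds S B → e B ∧ ∂ (e S) ≈ᴱ 0ᴱ
  crowds⇒e∧∂e {S = S} {B} crowds =
    ~0 (∧-comm~ (e-homogeneous B) (∂e-homogeneous S)) (crowds⇒∂e∧e (crowds-sym crowds))

  ∂² : (a : E n) → ∂ (∂ a) ≈ᴱ 0ᴱ
  ∂² {zero}  a []            = refl
  ∂² {suc n} a (outside ∷ S) = begin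
    ∂ (∂ (a ₀) +ᴱ a ₁) S + - ∂ (a ₁) S        ≈⟨ +-congʳ (∂-+ (∂ (a ₀)) (a ₁) S) ⟩
    (∂ (∂ (a ₀)) S + ∂ (a ₁) S) + - ∂ (a ₁) S ≈⟨ +-assoc _ _ _ ⟩
    ∂ (∂ (a ₀)) S + (∂ (a ₁) S + - ∂ (a ₁) S) ≈⟨ +-cong (∂² (a ₀) S) (-‿inverseʳ _) ⟩
    0# + 0#                                   ≈⟨ +-identityˡ 0# ⟩
    0#                                        ∎
  ∂² {suc n} a (inside  ∷ S) = begin
    - ∂ (-ᴱ ∂ (a ₁)) S   ≈⟨ -‿cong (∂-neg (∂ (a ₁)) S) ⟩
    - - ∂ (∂ (a ₁)) S    ≈⟨ -‿involutive _ ⟩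
    ∂ (∂ (a ₁)) S        ≈⟨ ∂² (a ₁) S ⟩
    0#                   ∎

  -- Apply `∂` to the vanishing product `∂ (e B) ∧ e S`: since `∂` squares to zero, the Leibniz rule
  -- leaves only `inv (∂ (e B)) ∧ ∂ (e S)`.
  crowds⇒∂e∧∂e : ∀ {S B : Subset n} → Crowds S B → ∂ (e B) ∧ ∂ (e S) ≈ᴱ 0ᴱ
  crowds⇒∂e∧∂e {S = S} {B} crowds =
    ~0 (∧-~-congʳ (~-sym (homogeneous⇒inv~ _ (∂e-homogeneous B)))) λ T → begin
      (inv (∂ (e B)) ∧ ∂ (e S)) T                           ≈⟨ +-identityˡ _ ⟨
      0# + (inv (∂ (e B)) ∧ ∂ (e S)) T
        ≈⟨ +-congʳ (trans (∧-congʳ (∂² (e B)) T) (∧-zeroˡ (e S) T)) ⟨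
      (∂ (∂ (e B)) ∧ e S) T + (inv (∂ (e B)) ∧ ∂ (e S)) T   ≈⟨ ∂-∧ (∂ (e B)) (e S) T ⟨
      ∂ (∂ (e B) ∧ e S) T                                   ≈⟨ ∂-cong (crowds⇒∂e∧e crowds) T ⟩
      ∂ 0ᴱ T                                                ≈⟨ ∂-0 T ⟩
      0#                                                    ∎

-- The element z(T) as a product over layers

module OrlikSolomonProperties {c ℓ} (R : CommutativeRing c ℓ)
                              {n : ℕ} (M : Matroid n) (simple : Matroid.Simple M) where
  open CommutativeRing R hiding (_-_; zero)
  open Matroid M
  open MatroidProperties M
  open Exterior R
  open ExteriorProperties R
  open OrlikSolomon M
  open RingProperties ring using (-1*x≈-x)
  open SetoidReasoning setoid

  ∏-++ : (as bs : List (E n)) → ∏ (as ++ bs) ≈ᴱ ∏ as ∧ ∏ bs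
  ∏-++ []       bs S = sym (∧-identityˡ (∏ bs) S)
  ∏-++ (a ∷ as) bs S = trans (∧-congˡ (∏-++ as bs) S) (sym (∧-assoc a (∏ as) (∏ bs) S))

  -- The head is the smallest element and yields the outermost block, which comes last among the
  -- boundary factors of `z`; hence the new factor on the right.
  layers : List (Fin n) → E n
  layers []       = 1ᴱ
  layers (x ∷ xs) = layers xs ∧ ∂ (e (layer x xs))

  flat-drop : List (Fin n) → ℕ → Subset n
  flat-drop xs q = flat (drop (length xs ∸ q) xs)

  flat-drop-∷ : ∀ x xs {q} → q ≤ length xs → flat-drop (x ∷ xs) q ≡ flat-drop xs q
  flat-drop-∷ x xs q≤ = ≡.cong (λ k → flat (drop k (x ∷ xs))) (ℕ.+-∸-assoc 1 q≤)

  flat-drop-length : ∀ xs → flat-drop xs (length xs) ≡ flat xs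
  flat-drop-length xs = ≡.cong (λ k → flat (drop k xs)) (ℕ.n∸n≡0 (length xs))

  layerForm : List (Fin n) → ℕ → E n
  layerForm xs q = ∂ (e (flat-drop xs (suc q) ─ flat-drop xs q))

  -- Peel off the last index. The other factors involve only suffixes of `xs`, so they are the same
  -- for `x ∷ xs` and for `xs`.
  ∏layers : ∀ xs → ∏ (map (layerForm xs) (upTo (length xs))) ≈ᴱ layers xs
  ∏layers []       S = refl
  ∏layers (x ∷ xs) S = begin
    ∏ (map f (upTo (suc (length xs)))) S
      ≡⟨ ≡.cong (λ qs → ∏ (map f qs) S) (List.upTo-∷ʳ (length xs)) ⟨
    ∏ (map f (upTo (length xs) ∷ʳ length xs)) S
      ≡⟨ ≡.cong (λ as → ∏ as S) (List.map-++ f (upTo (length xs)) (length xs ∷ [])) ⟩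
    ∏ (map f (upTo (length xs)) ∷ʳ f (length xs)) S
      ≈⟨ ∏-++ (map f (upTo (length xs))) (f (length xs) ∷ []) S ⟩
    (∏ (map f (upTo (length xs))) ∧ (f (length xs) ∧ 1ᴱ)) S
      ≡⟨ ≡.cong (λ as → (∏ as ∧ (f (length xs) ∧ 1ᴱ)) S) (List.map-cong-local (All.applyUpTo⁺₁ id (length xs) λ q< →
           ≡.cong₂ (λ A B → ∂ (e (A ─ B))) (flat-drop-∷ x xs q<) (flat-drop-∷ x xs (ℕ.<⇒≤ q<)))) ⟩
    (∏ (map (layerForm xs) (upTo (length xs))) ∧ (f (length xs) ∧ 1ᴱ)) S
      ≈⟨ ∧-cong (∏layers xs) (∧-identityʳ (f (length xs))) S ⟩
    (layers xs ∧ f (length xs)) S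
      ≡⟨ ≡.cong₂ (λ A B → (layers xs ∧ ∂ (e (A ─ B))) S) (flat-drop-length (x ∷ xs))
           (≡.trans (flat-drop-∷ x xs ℕ.≤-refl) (flat-drop-length xs)) ⟩
    layers (x ∷ xs) S ∎
    where
    f : ℕ → E n
    f = layerForm (x ∷ xs)

  X≡flat-drop : ∀ T q → X T q ≡ flat-drop (elements T) q
  X≡flat-drop T zero = ≡.sym (≡.trans
    (≡.cong flat (List.drop-all (length (elements T)) (elements T) ℕ.≤-refl)) (flat[]≡⊥ simple))
  X≡flat-drop T (suc q) = ≡.cong (λ k → flat (drop (k ∸ suc q) (elements T))) (≡.sym (length-elements T))

  outer : List (Fin n) → E n
  outer xs = e (∁ (flat xs))

  z~layers∧outer : ∀ T → z T ~ layers (elements T) ∧ outer (elements T)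
  z~layers∧outer T = inversions (σ T) , λ S → *-congˡ (∧-cong product
    (λ U → reflexive (≡.cong (λ A → e (∁ A) U) X∣T∣≡)) S)
    where
    X∣T∣≡ : X T ∣ T ∣ ≡ flat (elements T)
    X∣T∣≡ = ≡.trans (≡.cong (X T) (≡.sym (length-elements T)))
      (≡.trans (X≡flat-drop T (length (elements T))) (flat-drop-length (elements T)))

    product : ∏ (map (∂ ∘ e) (blocks T)) ≈ᴱ layers (elements T)
    product S = begin
      ∏ (map (∂ ∘ e) (map (block T) (upTo ∣ T ∣))) S
        ≡⟨ ≡.cong (λ as → ∏ as S) (List.map-∘ (upTo ∣ T ∣)) ⟨
      ∏ (map (∂ ∘ e ∘ block T) (upTo ∣ T ∣)) S
        ≡⟨ ≡.cong (λ as → ∏ as S) (List.map-cong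
             (λ q → ≡.cong₂ (λ A B → ∂ (e (A ─ B))) (X≡flat-drop T (suc q)) (X≡flat-drop T q)) (upTo ∣ T ∣)) ⟩
      ∏ (map (layerForm (elements T)) (upTo ∣ T ∣)) S
        ≡⟨ ≡.cong (λ k → ∏ (map (layerForm (elements T)) (upTo k)) S) (length-elements T) ⟨
      ∏ (map (layerForm (elements T)) (upTo (length (elements T)))) S
        ≈⟨ ∏layers (elements T) S ⟩
      layers (elements T) S ∎

  -- z(T) annihilates the Orlik-Solomon ideal

  -- `b` stands for `e S` or `∂ (e S)`. The free factor `y` collects the layers between the crowded
  -- one and `b`.
  layers-crowded : ∀ {S b xs} → (∀ B → Crowds S B → ∂ (e B) ∧ b ≈ᴱ 0ᴱ) →
                   Crowded S xs → ∀ y → layers xs ∧ (y ∧ b) ≈ᴱ 0ᴱ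
  layers-crowded {b = b} {x ∷ xs} kill (here crowds) y U = begin
    ((layers xs ∧ d) ∧ (y ∧ b)) U   ≈⟨ ∧-assoc (layers xs) d (y ∧ b) U ⟩
    (layers xs ∧ (d ∧ (y ∧ b))) U   ≈⟨ ∧-congˡ (∧-absorb (∂e-homogeneous (layer x xs)) (kill _ crowds) y) U ⟩
    (layers xs ∧ 0ᴱ) U              ≈⟨ ∧-zeroʳ (layers xs) U ⟩
    0#                              ∎
    where
    d : E n
    d = ∂ (e (layer x xs))
  layers-crowded {b = b} {x ∷ xs} kill (there crowded) y U = begin
    ((layers xs ∧ d) ∧ (y ∧ b)) U   ≈⟨ ∧-assoc (layers xs) d (y ∧ b) U ⟩
    (layers xs ∧ (d ∧ (y ∧ b))) U   ≈⟨ ∧-congˡ (∧-assoc d y b) U ⟨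
    (layers xs ∧ ((d ∧ y) ∧ b)) U   ≈⟨ layers-crowded kill crowded (d ∧ y) U ⟩
    0#                              ∎
    where
    d : E n
    d = ∂ (e (layer x xs))

  -- The arbitrary `y` strengthens the induction over the ideal: a left multiple of a member is
  -- absorbed into it.
  layers∧outer-annihilates : ∀ xs → NBC (fromList xs) → ∀ {b} → b ∈I →
                             ∀ y → (layers xs ∧ outer xs) ∧ (y ∧ b) ≈ᴱ 0ᴱ
  layers∧outer-annihilates xs nbc = go
    where
    w : E n
    w = layers xs ∧ outer xs

    go : ∀ {b} → b ∈I → ∀ y → w ∧ (y ∧ b) ≈ᴱ 0ᴱ
    go (generator S dep) y U with crowded? S xs
    ... | yes crowded = begin
      (w ∧ (y ∧ ∂ (e S))) U                         ≈⟨ ∧-assoc (layers xs) (outer xs) (y ∧ ∂ (e S)) U ⟩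
      (layers xs ∧ (outer xs ∧ (y ∧ ∂ (e S)))) U    ≈⟨ ∧-congˡ (∧-assoc (outer xs) y (∂ (e S))) U ⟨
      (layers xs ∧ ((outer xs ∧ y) ∧ ∂ (e S))) U
        ≈⟨ layers-crowded (λ B → crowds⇒∂e∧∂e) crowded (outer xs ∧ y) U ⟩
      0#                                            ∎
    ... | no ¬crowded with crowds? S (∁ (flat xs))
    ...   | no ¬crowds = contradiction (uncrowded⇒indep simple {S} xs nbc ¬crowded ¬crowds) dep
    ...   | yes crowds = begin
      (w ∧ (y ∧ ∂ (e S))) U                         ≈⟨ ∧-assoc (layers xs) (outer xs) (y ∧ ∂ (e S)) U ⟩
      (layers xs ∧ (outer xs ∧ (y ∧ ∂ (e S)))) U
        ≈⟨ ∧-congˡ (∧-absorb (e-homogeneous (∁ (flat xs))) (crowds⇒e∧∂e crowds) y) U ⟩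
      (layers xs ∧ 0ᴱ) U                            ≈⟨ ∧-zeroʳ (layers xs) U ⟩
      0#                                            ∎
    go (resp {a} {b} a≈b a∈I) y U = trans (∧-congˡ (∧-congˡ (λ V → sym (a≈b V))) U) (go a∈I y U)
    go zero∈ y U = trans (∧-congˡ (∧-zeroʳ y) U) (∧-zeroʳ w U)
    go (add∈ {a} {b} a∈I b∈I) y U = begin
      (w ∧ (y ∧ (a +ᴱ b))) U               ≈⟨ ∧-congˡ (∧-distribˡ y a b) U ⟩
      (w ∧ ((y ∧ a) +ᴱ (y ∧ b))) U         ≈⟨ ∧-distribˡ w (y ∧ a) (y ∧ b) U ⟩
      (w ∧ (y ∧ a)) U + (w ∧ (y ∧ b)) U    ≈⟨ +-cong (go a∈I y U) (go b∈I y U) ⟩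
      0# + 0#                              ≈⟨ +-identityˡ 0# ⟩
      0#                                   ∎
    go (left∈ a {b} b∈I) y U = trans (∧-congˡ (λ V → sym (∧-assoc y a b V)) U) (go b∈I (y ∧ a) U)
    go (right∈ {a} b a∈I) y U = begin
      (w ∧ (y ∧ (a ∧ b))) U    ≈⟨ ∧-congˡ (∧-assoc y a b) U ⟨
      (w ∧ ((y ∧ a) ∧ b)) U    ≈⟨ ∧-assoc w (y ∧ a) b U ⟨
      ((w ∧ (y ∧ a)) ∧ b) U    ≈⟨ ∧-congʳ (go a∈I y) U ⟩
      (0ᴱ ∧ b) U               ≈⟨ ∧-zeroˡ b U ⟩
      0#                       ∎

  nbc-elements : ∀ T → NBC T → NBC (fromList (elements T))
  nbc-elements T = ≡.subst NBC (≡.sym (fromList-elements T))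

  z∈I⁰ : ∀ {T} → NBC T → z T ∈I⁰
  z∈I⁰ {T} nbc b b∈I = ~0 (∧-~-congʳ (z~layers∧outer T)) λ U →
    trans (∧-congˡ (λ V → sym (∧-identityˡ b V)) U)
          (layers∧outer-annihilates (elements T) (nbc-elements T nbc) b∈I 1ᴱ U)

  -- The degree of z(T)

  ∣flat∣≡∣flat∣+∣layer∣ : ∀ x xs → NBC (fromList (x ∷ xs)) →
                          ∣ flat (x ∷ xs) ∣ ≡ ∣ flat xs ∣ ℕ.+ ∣ layer x xs ∣
  ∣flat∣≡∣flat∣+∣layer∣ x xs nbc = ∣q∣≡∣p∣+∣q─p∣ (flat-⊆-∷ x xs nbc)

  layers-homogeneous : ∀ {xs} → Sorted xs → NBC (fromList xs) →
                       ∃[ d ] Homogeneous d (layers xs) × ∣ flat xs ∣ ≡ length xs ℕ.+ d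
  layers-homogeneous {[]} _ _ = 0 , 1-homogeneous {n} ,
    ≡.trans (≡.cong ∣_∣ (flat[]≡⊥ simple)) (∣⊥∣≡0 n)
  layers-homogeneous {x ∷ xs} sorted@(_ ∷ sorted-xs) nbc
    with d , hom , ∣flat∣≡ ← layers-homogeneous sorted-xs (nbc-tail x xs nbc)
    -- The layer contains `x`, which rules out size zero, where the truncated `∸ 1` would not lower
    -- the degree by one.
    with ∣ layer x xs ∣ in ∣layer∣≡ | x∈p⇒∣p-x∣<∣p∣ (∈layer sorted nbc) | ∂e-homogeneous (layer x xs)
  ... | suc k | _ | ∂-hom = d ℕ.+ k , hom-∧ d k hom ∂-hom , ≡-begin
      where
      ≡-begin : ∣ flat (x ∷ xs) ∣ ≡ suc (length xs) ℕ.+ (d ℕ.+ k)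
      ≡-begin = ≡.trans (∣flat∣≡∣flat∣+∣layer∣ x xs nbc) (≡.trans (≡.cong₂ ℕ._+_ ∣flat∣≡ ∣layer∣≡)
        (≡.trans (ℕ.+-suc (length xs ℕ.+ d) k) (≡.cong suc (ℕ.+-assoc (length xs) d k))))

  z-homogeneous : ∀ {T} → NBC T → Homogeneous (n ∸ ∣ T ∣) (z T)
  z-homogeneous {T} nbc
    with k , z≈ ← z~layers∧outer T
    with d , hom , ∣flat∣≡ ← layers-homogeneous (elements-sorted T) (nbc-elements T nbc)
    = hom-cong (λ U → sym (z≈ U)) (hom-· (sgn k)
        (≡.subst (λ m → Homogeneous m (layers (elements T) ∧ outer (elements T))) degree≡
          (hom-∧ d _ hom (e-homogeneous (∁ F)))))
    where
    F : Subset n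
    F = flat (elements T)

    degree≡ : d ℕ.+ ∣ ∁ F ∣ ≡ n ∸ ∣ T ∣
    degree≡ = ≡R.begin
      d ℕ.+ ∣ ∁ F ∣                         ≡R.≡⟨ ≡.cong (d ℕ.+_) (∣∁p∣≡n∸∣p∣ F) ⟩
      d ℕ.+ (n ∸ ∣ F ∣)                     ≡R.≡⟨ ℕ.+-∸-assoc d (∣p∣≤n F) ⟨
      (d ℕ.+ n) ∸ ∣ F ∣                     ≡R.≡⟨ ≡.cong ((d ℕ.+ n) ∸_) (≡.trans ∣flat∣≡ (ℕ.+-comm _ d)) ⟩
      (d ℕ.+ n) ∸ (d ℕ.+ length (elements T)) ≡R.≡⟨ ℕ.[m+n]∸[m+o]≡n∸o d n _ ⟩
      n ∸ length (elements T)               ≡R.≡⟨ ≡.cong (n ∸_) (length-elements T) ⟩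
      n ∸ ∣ T ∣                             ≡R.∎
      where module ≡R = ≡.≡-Reasoning

  -- Pairing z(T) with nbc-monomials

  -- Each generator of the list is carried to the boundary of its own layer, where `gen-∧-∂e`
  -- restores the full monomial of that layer; the layers then multiply up to the flat.
  e-fromList∧layers : ∀ {xs} → Sorted xs → NBC (fromList xs) → e (fromList xs) ∧ layers xs ~ e (flat xs)
  e-fromList∧layers {[]} _ _ = ≈⇒~ λ S → trans (∧-identityʳ (e ⊥) S)
    (reflexive (≡.cong (λ A → e A S) (≡.sym (flat[]≡⊥ simple))))
  e-fromList∧layers {x ∷ xs} sorted@(_ ∷ sorted-xs) nbc = ~R.begin
    e (fromList (x ∷ xs)) ∧ (w ∧ d)
      ~R.≈⟨ ∧-~-congʳ (e-∧ {A = ⁅ x ⁆} {fromList xs} λ y∈⁅x⁆ y∈ →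
           sorted⇒∉ sorted (≡.subst (_∈ fromList xs) (x∈⁅y⁆⇒x≡y x y∈⁅x⁆) y∈)) ⟨
    (e ⁅ x ⁆ ∧ e (fromList xs)) ∧ (w ∧ d)
      ~R.≈⟨ ≈⇒~ (λ S → trans (∧-assoc (e ⁅ x ⁆) (e (fromList xs)) (w ∧ d) S)
                          (∧-cong (λ T → sym (gen≈e x T)) (λ T → sym (∧-assoc (e (fromList xs)) w d T)) S)) ⟩
    gen x ∧ ((e (fromList xs) ∧ w) ∧ d)
      ~R.≈⟨ ∧-~-congˡ (∧-~-congʳ (e-fromList∧layers sorted-xs (nbc-tail x xs nbc))) ⟩
    gen x ∧ (e F ∧ d)
      ~R.≈⟨ ≈⇒~ (∧-assoc (gen x) (e F) d) ⟨
    (gen x ∧ e F) ∧ d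
      ~R.≈⟨ ∧-~-congʳ (∧-comm~ (gen-homogeneous x) (e-homogeneous F)) ⟩
    (e F ∧ gen x) ∧ d
      ~R.≈⟨ ≈⇒~ (∧-assoc (e F) (gen x) d) ⟩
    e F ∧ (gen x ∧ d)
      ~R.≈⟨ ≈⇒~ (∧-congˡ (gen-∧-∂e (∈layer sorted nbc))) ⟩
    e F ∧ e (layer x xs)
      ~R.≈⟨ e-∧ (λ y∈F y∈layer → x∉p─q (flat (x ∷ xs)) y∈F y∈layer) ⟩
    e (F ∪ layer x xs)
      ~R.≡⟨ ≡.cong e (⊆-antisym (∈∪-caseʳ {p = F} (flat-⊆-∷ x xs nbc) (p─q⊆p (flat (x ∷ xs)) F)) ⊆F∪) ⟩
    e (flat (x ∷ xs)) ~R.∎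
    where
    module ~R = SetoidReasoning (~-setoid n)

    w d : E n
    w = layers xs
    d = ∂ (e (layer x xs))

    F : Subset n
    F = flat xs

    ⊆F∪ : flat (x ∷ xs) ⊆ F ∪ layer x xs
    ⊆F∪ {y} y∈ with y ∈? F
    ... | yes y∈F = p⊆p∪q (layer x xs) y∈F
    ... | no  y∉F = q⊆p∪q F (layer x xs) (x∈p∧x∉q⇒x∈p─q y∈ y∉F)

  z∧e~e⊤ : ∀ {T} → NBC T → z T ∧ e T ~ e ⊤
  z∧e~e⊤ {T} nbc = ~R.begin
    z T ∧ e T                     ~R.≈⟨ ∧-comm~ (z-homogeneous nbc) (e-homogeneous T) ⟩
    e T ∧ z T                     ~R.≈⟨ ∧-~-congˡ (z~layers∧outer T) ⟩
    e T ∧ (layers xs ∧ outer xs)  ~R.≈⟨ ≈⇒~ (∧-assoc (e T) (layers xs) (outer xs)) ⟨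
    (e T ∧ layers xs) ∧ outer xs  ~R.≡⟨ ≡.cong (λ A → (e A ∧ layers xs) ∧ outer xs) (fromList-elements T) ⟨
    (e (fromList xs) ∧ layers xs) ∧ outer xs
      ~R.≈⟨ ∧-~-congʳ (e-fromList∧layers (elements-sorted T) (nbc-elements T nbc)) ⟩
    e (flat xs) ∧ outer xs        ~R.≈⟨ e-∧ x∈p⇒x∉∁p ⟩
    e (flat xs ∪ ∁ (flat xs))     ~R.≡⟨ ≡.cong e (p∪∁p≡⊤ (flat xs)) ⟩
    e ⊤                           ~R.∎
    where
    module ~R = SetoidReasoning (~-setoid n)
    xs : List (Fin n)
    xs = elements T

  z-pairing-diagonal : ∀ {T} → NBC T → ∃ λ k → (z T ∧ e T) ⊤ ≈ sgn k
  z-pairing-diagonal {T} nbc = let k , eq = z∧e~e⊤ {T} nbc in k , (begin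
    (z T ∧ e T) ⊤       ≈⟨ eq ⊤ ⟩
    sgn k * e full full       ≈⟨ *-congˡ (e≈basis full full) ⟩
    sgn k * basis full full   ≈⟨ *-congˡ (reflexive (≡.cong (if_then 1# else 0#) (dec-true (full ≟ˢ full) ≡.refl))) ⟩
    sgn k * 1#          ≈⟨ *-identityʳ _ ⟩
    sgn k               ∎)
    where
    full : Subset n
    full = ⊤

  z-pairing-offDiagonal : ∀ {S T} → NBC S → NBC T → ∣ S ∣ ≡ ∣ T ∣ → T ≢ S → z T ∧ e S ≈ᴱ 0ᴱ
  z-pairing-offDiagonal {S} {T} S-nbc T-nbc ∣S∣≡∣T∣ T≢S =
    ~0 (∧-~-congʳ (z~layers∧outer T)) λ U → trans (∧-assoc (layers xs) (outer xs) (e S) U) (vanishes U)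
    where
    xs : List (Fin n)
    xs = elements T

    vanishes : layers xs ∧ (outer xs ∧ e S) ≈ᴱ 0ᴱ
    vanishes with crowded? S xs
    ... | yes crowded = layers-crowded (λ B → crowds⇒∂e∧e) crowded (outer xs)
    ... | no ¬crowded with S ⊆? flat xs
    ...   | yes S⊆ = contradiction (nbc-transversal⇒≡ simple S-nbc T-nbc ∣S∣≡∣T∣ ¬crowded S⊆) T≢S
    ...   | no  S⊈ with Fin.any? (λ x → (x ∈? S) ×-dec ¬? (x ∈? flat xs))
    ...     | yes (x , x∈S , x∉flat) = λ U →
              trans (∧-congˡ (e-∧-overlap (x∉p⇒x∈∁p x∉flat) x∈S) U) (∧-zeroʳ (layers xs) U)
    ...     | no  ∄x = contradiction (λ {x} x∈S → inFlat x x∈S) S⊈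
      where
      inFlat : ∀ x → x ∈ S → x ∈ flat xs
      inFlat x x∈S with x ∈? flat xs
      ... | yes x∈ = x∈
      ... | no  x∉ = contradiction (x , x∈S , x∉) ∄x

  -- Straightening against broken circuits

  ∈I-~ : ∀ {a b : E n} → a ~ b → b ∈I → a ∈I
  ∈I-~ {a} {b} (k , a≈b) b∈I = resp (λ S → begin
    ((sgn k · 1ᴱ) ∧ b) S   ≈⟨ ·-∧ (sgn k) 1ᴱ b S ⟩
    sgn k * (1ᴱ ∧ b) S     ≈⟨ *-congˡ (∧-identityˡ b S) ⟩
    sgn k * b S            ≈⟨ a≈b S ⟨
    a S                    ∎) (left∈ (sgn k · 1ᴱ) b∈I)

  ∂-~ : ∀ {a b : E n} → a ~ b → ∂ a ~ ∂ b
  ∂-~ {a} {b} (k , a≈b) = k , λ S → trans (∂-cong a≈b S) (∂-· (sgn k) b S)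

  -- Modulo I, the monomial of a broken circuit B = C - i is eᵢ ∂e_B, a combination of
  -- the monomials of B - j + i; multiplying by e_D replaces B ∪ D by lexicographically earlier sets.
  straighten : ∀ {b C i D} → b ∈I⁰ → Circuit C → i ∈ C → Disjoint (C - i) D →
               (∀ S′ → i ∈ S′ → D ⊆ S′ → i ∉ D → (b ∧ e S′) ⊤ ≈ 0#) →
               (b ∧ e ((C - i) ∪ D)) ⊤ ≈ 0#
  straighten {b} {C} {i} {D} b∈I⁰ C-circuit i∈C disj earlier =
    ~0-at ⊤ (∧-~-congˡ (~-sym (e-∧ disj))) (begin
      (b ∧ (e B ∧ e D)) ⊤                           ≈⟨ ∧-assoc b (e B) (e D) ⊤ ⟨
      ((b ∧ e B) ∧ e D) ⊤                           ≈⟨ ∧-congʳ b∧eB ⊤ ⟩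
      ((b ∧ (gen i ∧ ∂ (e B))) ∧ e D) ⊤             ≈⟨ ∧-congʳ (∧-assoc b (gen i) (∂ (e B))) ⊤ ⟨
      (((b ∧ gen i) ∧ ∂ (e B)) ∧ e D) ⊤             ≈⟨ ∧-assoc (b ∧ gen i) (∂ (e B)) (e D) ⊤ ⟩
      ((b ∧ gen i) ∧ (∂ (e B) ∧ e D)) ⊤
        ≈⟨ sandwich-zero (b ∧ gen i) (∂ (e B)) (e D) ⊤ (λ A → term A (∂e-support B A)) ⟩
      0#                                            ∎)
    where
    B : Subset n
    B = C - i

    ⁅i⁆∪B≡C : ⁅ i ⁆ ∪ B ≡ C
    ⁅i⁆∪B≡C = ⊆-antisym (∈∪-caseʳ {p = ⁅ i ⁆} (⁅x⁆⊆ i∈C) (p─q⊆p C ⁅ i ⁆)) C⊆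
      where
      C⊆ : C ⊆ ⁅ i ⁆ ∪ B
      C⊆ {x} x∈C with x Fin.≟ i
      ... | yes ≡.refl = p⊆p∪q B (x∈⁅x⁆ i)
      ... | no  x≢i    = q⊆p∪q ⁅ i ⁆ B (x∈p∧x≢y⇒x∈p-y x∈C x≢i)

    gen∧eB~eC : gen i ∧ e B ~ e C
    gen∧eB~eC = ~-trans (∧-~-congʳ (≈⇒~ (gen≈e i))) (~-trans
      (e-∧ λ x∈⁅i⁆ x∈B → x∉p─q C x∈⁅i⁆ x∈B)
      (≈⇒~ λ S → reflexive (≡.cong (λ A → e A S) ⁅i⁆∪B≡C)))

    b∧eB : b ∧ e B ≈ᴱ b ∧ (gen i ∧ ∂ (e B))
    b∧eB S = begin
      (b ∧ e B) S                                     ≈⟨ +-identityʳ _ ⟨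
      (b ∧ e B) S + 0#                                ≈⟨ +-congˡ (-‿inverseˡ _) ⟨
      (b ∧ e B) S + (- (b ∧ y) S + (b ∧ y) S)         ≈⟨ +-assoc _ _ _ ⟨
      ((b ∧ e B) S + - (b ∧ y) S) + (b ∧ y) S         ≈⟨ +-congʳ (+-congˡ (∧-negʳ b y S)) ⟨
      ((b ∧ e B) S + (b ∧ (-ᴱ y)) S) + (b ∧ y) S      ≈⟨ +-congʳ (∧-distribˡ b (e B) (-ᴱ y) S) ⟨
      (b ∧ (e B +ᴱ (-ᴱ y))) S + (b ∧ y) S             ≈⟨ +-congʳ (∧-congˡ (∂-gen-∧ i (e B)) S) ⟨
      (b ∧ ∂ (gen i ∧ e B)) S + (b ∧ y) S
        -- Up to sign `gen i ∧ e B` is `e C`, so its boundary is a generator of `I` and is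
        -- annihilated by `b`.
        ≈⟨ +-congʳ (b∈I⁰ _ (∈I-~ (∂-~ gen∧eB~eC) (generator C (proj₁ C-circuit))) S) ⟩
      0# + (b ∧ y) S                                  ≈⟨ +-identityˡ _ ⟩
      (b ∧ y) S                                       ∎
      where
      y : E n
      y = gen i ∧ ∂ (e B)

    term : ∀ A → ∂ (e B) A ≈ 0# ⊎ ∃[ j ] j ∈ B × A ≡ B - j →
           ∂ (e B) A ≈ 0# ⊎ ((b ∧ gen i) ∧ (e A ∧ e D)) ⊤ ≈ 0#
    term A (inj₁ eq)                 = inj₁ eq
    term A (inj₂ (j , j∈B , ≡.refl)) = inj₂ (~0-at ⊤ shuffle replaced)
      where
      A∪D : Subset n
      A∪D = (B - j) ∪ D

      shuffle : (b ∧ gen i) ∧ (e (B - j) ∧ e D) ~ b ∧ (e ⁅ i ⁆ ∧ e A∪D)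
      shuffle = ~-trans (≈⇒~ (∧-assoc b (gen i) (e (B - j) ∧ e D)))
        (∧-~-congˡ (~-trans (∧-~-congʳ (≈⇒~ (gen≈e i)))
          (∧-~-congˡ (e-∧ (disj ∘ p─q⊆p B ⁅ j ⁆)))))

      replaced : (b ∧ (e ⁅ i ⁆ ∧ e A∪D)) ⊤ ≈ 0#
      replaced with i ∈? A∪D
      -- If `i` is already present, the product is zero; otherwise `i` is new, in particular absent
      -- from `D`, and `earlier` applies.
      ... | yes i∈ = trans (∧-congˡ (e-∧-overlap (x∈⁅x⁆ i) i∈) ⊤) (∧-zeroʳ b ⊤)
      ... | no  i∉ = ~0-at ⊤
        (∧-~-congˡ (e-∧ λ x∈⁅i⁆ x∈ → i∉ (≡.subst (_∈ A∪D) (x∈⁅y⁆⇒x≡y i x∈⁅i⁆) x∈)))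
        (earlier (⁅ i ⁆ ∪ A∪D) (p⊆p∪q A∪D (x∈⁅x⁆ i))
          (q⊆p∪q ⁅ i ⁆ A∪D ∘ q⊆p∪q (B - j) D) (i∉ ∘ q⊆p∪q (B - j) D))

  module _ {b : E n} (b∈I⁰ : b ∈I⁰) (b∧nbc≈0 : ∀ T → NBC T → (b ∧ e T) ⊤ ≈ 0#) where

    -- Well-founded induction on `weight`: a set that is not nbc contains a broken circuit, and
    -- `straighten` reduces it to sets of smaller weight.
    nbc-determined : ∀ S → (b ∧ e S) ⊤ ≈ 0#
    nbc-determined S = go S (<-wellFounded (weight S))
      where
      go : ∀ S → Acc ℕ._<_ (weight S) → (b ∧ e S) ⊤ ≈ 0#
      go S (acc rec) with anySubset? (λ B → brokenCircuit? B ×-dec (B ⊆? S))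
      ... | no  ∄B = b∧nbc≈0 S λ B B-bc B⊆S → ∄B (B , B-bc , λ {x} → B⊆S {x})
      ... | yes (_ , (C , i , C-circuit , (i∈C , i-min) , ≡.refl) , B⊆S) =
        ≡.subst (λ A → (b ∧ e A) ⊤ ≈ 0#) B∪D≡S
          (straighten b∈I⁰ C-circuit i∈C (λ x∈B x∈D → x∉p─q S x∈B x∈D)
            -- `S′` gains `i`, which `S` lacks, and keeps every element of `S` below `i`: the broken
            -- circuit has no element below `i`, so those elements lie in `D`.
            λ S′ i∈S′ D⊆S′ i∉D → go S′ (rec (weight-decreases i∈S′ (i∉S i∉D) (below S′ D⊆S′))))
        where
        B D : Subset n
        B = C - i
        D = S ─ B

        B∪D≡S : B ∪ D ≡ S
        B∪D≡S = ⊆-antisym (∈∪-caseʳ {p = B} B⊆S (p─q⊆p S B)) S⊆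
          where
          S⊆ : S ⊆ B ∪ D
          S⊆ {x} x∈S with x ∈? B
          ... | yes x∈B = p⊆p∪q D x∈B
          ... | no  x∉B = q⊆p∪q B D (x∈p∧x∉q⇒x∈p─q x∈S x∉B)

        i∉S : i ∉ D → i ∉ S
        i∉S i∉D i∈S = i∉D (x∈p∧x∉q⇒x∈p─q i∈S (x∉p─q C (x∈⁅x⁆ i)))

        below : ∀ S′ → D ⊆ S′ → ∀ {k} → k Fin.< i → k ∈ S → k ∈ S′
        below S′ D⊆S′ {k} k<i k∈S = D⊆S′ (x∈p∧x∉q⇒x∈p─q k∈S λ k∈B →
          ℕ.<⇒≱ k<i (i-min k (p─q⊆p C ⁅ i ⁆ k∈B)))

  -- Independence and spanning

  ∑-∧-zero : ∀ {k} (v : Fin k → E n) x S → (∀ i → (v i ∧ x) S ≈ 0#) → (∑ v ∧ x) S ≈ 0#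
  ∑-∧-zero {zero}  v x S v≈0 = ∧-zeroˡ x S
  ∑-∧-zero {suc k} v x S v≈0 = begin
    ((v zero +ᴱ ∑ (v ∘ suc)) ∧ x) S            ≈⟨ ∧-distribʳ x (v zero) (∑ (v ∘ suc)) S ⟩
    (v zero ∧ x) S + (∑ (v ∘ suc) ∧ x) S       ≈⟨ +-cong (v≈0 zero) (∑-∧-zero (v ∘ suc) x S (v≈0 ∘ suc)) ⟩
    0# + 0#                                    ≈⟨ +-identityˡ 0# ⟩
    0#                                         ∎

  ∑-∧-single : ∀ {k} (v : Fin k → E n) x S j → (∀ i → i ≢ j → (v i ∧ x) S ≈ 0#) → (∑ v ∧ x) S ≈ (v j ∧ x) S
  ∑-∧-single {suc k} v x S zero v≈0 = begin
    ((v zero +ᴱ ∑ (v ∘ suc)) ∧ x) S            ≈⟨ ∧-distribʳ x (v zero) (∑ (v ∘ suc)) S ⟩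
    (v zero ∧ x) S + (∑ (v ∘ suc) ∧ x) S       ≈⟨ +-congˡ (∑-∧-zero (v ∘ suc) x S λ i → v≈0 (suc i) λ ()) ⟩
    (v zero ∧ x) S + 0#                        ≈⟨ +-identityʳ _ ⟩
    (v zero ∧ x) S                             ∎
  ∑-∧-single {suc k} v x S (suc j) v≈0 = begin
    ((v zero +ᴱ ∑ (v ∘ suc)) ∧ x) S            ≈⟨ ∧-distribʳ x (v zero) (∑ (v ∘ suc)) S ⟩
    (v zero ∧ x) S + (∑ (v ∘ suc) ∧ x) S
      ≈⟨ +-cong (v≈0 zero λ ()) (∑-∧-single (v ∘ suc) x S j λ i i≢j → v≈0 (suc i) (i≢j ∘ Fin.suc-injective)) ⟩
    0# + (v (suc j) ∧ x) S                     ≈⟨ +-identityˡ _ ⟩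
    (v (suc j) ∧ x) S                          ∎

  ∑-homogeneous : ∀ {k d} (v : Fin k → E n) → (∀ i → Homogeneous d (v i)) → Homogeneous d (∑ v)
  ∑-homogeneous {zero}  v hom S _ = refl
  ∑-homogeneous {suc k} v hom     = hom-+ (hom zero) (∑-homogeneous (v ∘ suc) (hom ∘ suc))

  +∈I⁰ : ∀ {a b} → a ∈I⁰ → b ∈I⁰ → a +ᴱ b ∈I⁰
  +∈I⁰ {a} {b} a∈ b∈ x x∈I S =
    trans (∧-distribʳ x a b S) (trans (+-cong (a∈ x x∈I S) (b∈ x x∈I S)) (+-identityˡ 0#))

  ·∈I⁰ : ∀ r {a} → a ∈I⁰ → r · a ∈I⁰
  ·∈I⁰ r {a} a∈ x x∈I S = trans (·-∧ r a x S) (trans (*-congˡ (a∈ x x∈I S)) (zeroʳ r))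

  ∑∈I⁰ : ∀ {k} (v : Fin k → E n) → (∀ i → v i ∈I⁰) → ∑ v ∈I⁰
  ∑∈I⁰ v v∈ x x∈I S = ∑-∧-zero v x S λ i → v∈ i x x∈I S

  module _ {p : ℕ} (p≤n : p ≤ n) where

    T : Fin (length (nbc p)) → Subset n
    T = lookup (nbc p)

    private
      nbc-p? = λ S → nbc? S ×-dec (∣ S ∣ ℕ.≟ p)

    T∈nbc : ∀ i → NBC (T i) × ∣ T i ∣ ≡ p
    T∈nbc i = proj₂ (∈-filter⁻ nbc-p? {xs = subsets n} (∈-lookup i))

    T-surjective : ∀ {S} → NBC S → ∣ S ∣ ≡ p → ∃[ i ] S ≡ T i
    T-surjective {S} S-nbc ∣S∣≡p = Any.index S∈ , Any.lookup-index S∈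
      where
      S∈ : S ∈ˡ nbc p
      S∈ = ∈-filter⁺ nbc-p? (subsets-complete S) (S-nbc , ∣S∣≡p)

    T-injective : ∀ {i j} → T i ≡ T j → i ≡ j
    T-injective {i} {j} = lookup-injective (Unique.filter⁺ nbc-p? (subsets-unique n)) i j

    v : Fin (length (nbc p)) → E n
    v i = z (T i)

    member : ∀ i → I⁰-component (n ∸ p) (v i)
    member i = let T-nbc , ∣T∣≡p = T∈nbc i in
      z∈I⁰ T-nbc , ≡.subst (λ m → Homogeneous (n ∸ m) (v i)) ∣T∣≡p (z-homogeneous T-nbc)

    abstract
      diagonal : ∀ i → ∃ λ k → (v i ∧ e (T i)) ⊤ ≈ sgn k
      diagonal i = z-pairing-diagonal {T i} (proj₁ (T∈nbc i))

    offDiagonal : ∀ i j → i ≢ j → v i ∧ e (T j) ≈ᴱ 0ᴱ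
    offDiagonal i j i≢j = z-pairing-offDiagonal {T j} {T i} (proj₁ (T∈nbc j)) (proj₁ (T∈nbc i))
      (≡.trans (proj₂ (T∈nbc j)) (≡.sym (proj₂ (T∈nbc i)))) (i≢j ∘ T-injective)

    exponent : Fin (length (nbc p)) → ℕ
    exponent i = proj₁ (diagonal i)

    combination∧e : ∀ (r : Fin (length (nbc p)) → Carrier) j →
                    (∑ (λ i → r i · v i) ∧ e (T j)) ⊤ ≈ sgn (exponent j) * r j
    combination∧e r j = begin
      (∑ (λ i → r i · v i) ∧ e (T j)) ⊤   ≈⟨ ∑-∧-single (λ i → r i · v i) (e (T j)) ⊤ j off ⟩
      ((r j · v j) ∧ e (T j)) ⊤           ≈⟨ ·-∧ (r j) (v j) (e (T j)) ⊤ ⟩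
      r j * (v j ∧ e (T j)) ⊤             ≈⟨ *-congˡ (proj₂ (diagonal j)) ⟩
      r j * sgn (exponent j)              ≈⟨ *-comm _ _ ⟩
      sgn (exponent j) * r j              ∎
      where
      off : ∀ i → i ≢ j → ((r i · v i) ∧ e (T j)) ⊤ ≈ 0#
      off i i≢j = trans (·-∧ (r i) (v i) (e (T j)) ⊤) (trans (*-congˡ (offDiagonal i j i≢j ⊤)) (zeroʳ _))

    independent : ∀ (r : Fin (length (nbc p)) → Carrier) → ∑ (λ i → r i · v i) ≈ᴱ 0ᴱ → ∀ j → r j ≈ 0#
    independent r ∑≈0 j = sgn-cancel (exponent j) (begin
      sgn (exponent j) * r j               ≈⟨ combination∧e r j ⟨
      (∑ (λ i → r i · v i) ∧ e (T j)) ⊤    ≈⟨ ∧-congʳ {b = e (T j)} ∑≈0 ⊤ ⟩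
      (0ᴱ ∧ e (T j)) ⊤                     ≈⟨ ∧-zeroˡ (e (T j)) ⊤ ⟩
      0#                                   ∎)

    module _ {a : E n} (a∈I⁰ : a ∈I⁰) (a-hom : Homogeneous (n ∸ p) a) where
      -- A sign is its own inverse, so multiplying by `sgn (exponent j)` divides by the diagonal
      -- entry of the pairing.
      coordinates : Fin (length (nbc p)) → Carrier
      coordinates j = sgn (exponent j) * (a ∧ e (T j)) ⊤

      s b : E n
      s = ∑ (λ i → coordinates i · v i)
      b = a +ᴱ (- 1# · s)

      b∈I⁰ : b ∈I⁰
      b∈I⁰ = +∈I⁰ {a} { - 1# · s} a∈I⁰ (·∈I⁰ (- 1#) {s}
        (∑∈I⁰ (λ i → coordinates i · v i) λ i → ·∈I⁰ (coordinates i) {v i} (proj₁ (member i))))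

      b-hom : Homogeneous (n ∸ p) b
      b-hom = hom-+ a-hom (hom-· (- 1#)
        (∑-homogeneous (λ i → coordinates i · v i) λ i → hom-· (coordinates i) (proj₂ (member i))))

      s∧e : ∀ j → (s ∧ e (T j)) ⊤ ≈ (a ∧ e (T j)) ⊤
      s∧e j = begin
        (s ∧ e (T j)) ⊤                                            ≈⟨ combination∧e coordinates j ⟩
        sgn (exponent j) * (sgn (exponent j) * (a ∧ e (T j)) ⊤)    ≈⟨ *-assoc _ _ _ ⟨
        (sgn (exponent j) * sgn (exponent j)) * (a ∧ e (T j)) ⊤    ≈⟨ *-congʳ (sgn² (exponent j)) ⟩
        1# * (a ∧ e (T j)) ⊤                                       ≈⟨ *-identityˡ _ ⟩
        (a ∧ e (T j)) ⊤                                            ∎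

      b∧e≈0 : ∀ j → (b ∧ e (T j)) ⊤ ≈ 0#
      b∧e≈0 j = begin
        (b ∧ e (T j)) ⊤                                   ≈⟨ ∧-distribʳ (e (T j)) a (- 1# · s) ⊤ ⟩
        (a ∧ e (T j)) ⊤ + ((- 1# · s) ∧ e (T j)) ⊤        ≈⟨ +-congˡ (·-∧ (- 1#) s (e (T j)) ⊤) ⟩
        (a ∧ e (T j)) ⊤ + - 1# * (s ∧ e (T j)) ⊤          ≈⟨ +-congˡ (trans (-1*x≈-x _) (-‿cong (s∧e j))) ⟩
        (a ∧ e (T j)) ⊤ + - (a ∧ e (T j)) ⊤               ≈⟨ -‿inverseʳ _ ⟩
        0#                                                ∎

      b∧nbc≈0 : ∀ S → NBC S → (b ∧ e S) ⊤ ≈ 0#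
      b∧nbc≈0 S S-nbc = go (∣ S ∣ ℕ.≟ p)
        where
        go : Dec (∣ S ∣ ≡ p) → (b ∧ e S) ⊤ ≈ 0#
        go (yes ∣S∣≡p) = let j , S≡T = T-surjective S-nbc ∣S∣≡p in
          ≡.subst (λ A → (b ∧ e A) ⊤ ≈ 0#) (≡.sym S≡T) (b∧e≈0 j)
        -- The product has degree `(n ∸ p) + ∣ S ∣`, which differs from `n`; here `p≤n` makes the
        -- truncated subtraction exact.
        go (no  ∣S∣≢p) = hom-∧ (n ∸ p) ∣ S ∣ {b} {e S} b-hom (e-homogeneous S) ⊤ λ n≡ →
          ∣S∣≢p (ℕ.+-cancelˡ-≡ (n ∸ p) ∣ S ∣ p
            (≡.trans (≡.sym n≡) (≡.trans (∣⊤∣≡n n) (≡.sym (ℕ.m∸n+n≡m p≤n)))))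

      b≈0 : b ≈ᴱ 0ᴱ
      b≈0 = pairing-nondegenerate b (nbc-determined b∈I⁰ b∧nbc≈0)

      a≈s : a ≈ᴱ s
      a≈s S = begin
        a S                       ≈⟨ +-identityʳ _ ⟨
        a S + 0#                  ≈⟨ +-congˡ (-‿inverseˡ _) ⟨
        a S + (- s S + s S)       ≈⟨ +-assoc _ _ _ ⟨
        (a S + - s S) + s S       ≈⟨ +-congʳ (+-congˡ (-1*x≈-x _)) ⟨
        b S + s S                 ≈⟨ +-congʳ (b≈0 S) ⟩
        0# + s S                  ≈⟨ +-identityˡ _ ⟩
        s S                       ∎

    spanning : ∀ a → I⁰-component (n ∸ p) a →
               ∃ λ (r : Fin (length (nbc p)) → Carrier) → a ≈ᴱ ∑ (λ i → r i · v i)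
    spanning a (a∈I⁰ , a-hom) = coordinates a∈I⁰ a-hom , a≈s a∈I⁰ a-hom

    z-isBasis : IsBasis (I⁰-component (n ∸ p)) v
    z-isBasis = record { member = member ; independent = independent ; spanning = spanning }

open Matroid
open Exterior
open OrlikSolomon

proposition3p8 : ∀ {c r} (R : CommutativeRing c r) → IsNontrivial R →
    ∀ {n} (M : Matroid n) → Simple M →
    ∀ (ℓ : ℕ) → rank M ⊤ ≡ ℓ →
    ∀ p → 1 ≤ p → p ≤ ℓ →
    IsBasis R (I⁰-component R M (n ∸ p)) (λ i → z R M (lookup (nbc M p) i))
proposition3p8 R _ {n} M simple ℓ rank≡ℓ p _ p≤ℓ = OrlikSolomonProperties.z-isBasis R M simple (begin
  p          ≤⟨ p≤ℓ ⟩
  ℓ          ≡⟨ rank≡ℓ ⟨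
  rank M ⊤   ≤⟨ MatroidProperties.rank-≤ M ⊤ (λ A _ _ → ∣p∣≤n A) ⟩
  n          ∎)
  where open ℕ.≤-Reasoning
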